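{- Let $P$ be a closed $\mathsf{HO}$ process (of the core fragment) with $\widetilde u=\mathtt{fn}(P)$, and let $\sigma=\{\mathsf{init}(\widetilde u)/\widetilde u\}$. If $\Gamma;\emptyset;\Delta\vdash P\triangleright\diamond$ (typability with standard session types), then $\mathcal G(\Gamma\sigma);\emptyset;\mathcal G(\Delta\sigma)\vdash \mathcal D(P)\triangleright\diamond$ (typability with minimal session types).
   Context: **Processes.** Names $n$ are shared names $a,b,c,\dots$ or session names $s,\overline s$ (disjoint sets); duality satisfies $\overline{\overline s}=s$, $\overline a=a$. Let $u,w$ range over names and variables. Values: $V::=x\mid \lambda x.P$. Core-fragment processes: $P,Q::=u!\langle V\rangle.P\mid u?(x).P\mid V\,u\mid P\mid Q\mid(\nu n)P\mid\mathbf 0$ (output, input, application, parallel composition, restriction, inaction); no labeled choice, no recursive types. $(\nu s)P$ binds $s$ and $\overline s$. $\mathtt{fv},\mathtt{fn}$ are free variables and names; $P$ is closed if $\mathtt{fv}(P)=\emptyset$. Processes are taken up to $\alpha$-conversion. The target language is polyadic: tuples $\widetilde V,\widetilde x,\widetilde u$ may be used in session communications, abstractions $\lambda\widetilde x.P$ and applications $V\,\widetilde u$ (not in communications on shared names). Trailing $\mathbf 0$ may be omitted. $\epsilon$ is the empty tuple. **Types.** $U::=C\rightarrow\diamond\mid C\multimap\diamond$ (shared / linear abstractions); $C::=S\mid\langle U\rangle$ ($\langle U\rangle$: shared channel); $S::=\mathsf{end}\mid\ !\langle U\rangle;S\mid\ ?(U);S$. $\diamond$ is the process type. Duality ($S_1\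 \mathsf{dual}\ S_2$) exchanges $!$ and $?$. Bound names and variables carry type annotations: $(\nu s:C)P$, and $\lambda x:C^{\leadsto}.P$ with $\leadsto\in\{\multimap,\rightarrow\}$ when the abstraction has type $C\leadsto\diamond$. *Minimal session types* (polyadic): $U::=\widetilde C\rightarrow\diamond\mid\widetilde C\multimap\diamond$; $C::=M\mid\langle U\rangle$; $M::=\mathsf{end}\mid\ !\langle\widetilde U\rangle;\mathsf{end}\mid\ ?(\widetilde U);\mathsf{end}$. **Typing.** Environments: $\Gamma$ maps variables to $C\rightarrow\diamond$ and names (or name variables) to $\langle U\rangle$; $\Lambda$ maps variables to $C\multimap\diamond$; $\Delta$ maps names (or name variables) to session types. $\Gamma$ admits weakening, contraction, exchange; $\Lambda,\Delta$ only exchange; domains are pairwise disjoint. Rules (the polyadic ones are the evident tuple versions; tuples are typed componentwise, splitting $\Lambda,\Delta$): - Sess: $\Gamma;\emptyset;u:S\vdash u\triangleright S$. Sh: $\Gamma,u:\langle U\rangle;\emptyset;\emptyset\vdash u\triangleright\langle U\rangle$. LVar: $\Gamma;x:C\multimap\diamond;\emptyset\vdash x\triangleright C\multimap\diamond$. Nil: $\Gamma;\emptyset;\emptyset\vdash\mathbf 0\triangleright\diamond$. - Prom: from $\Gamma;\emptyset;\emptyset\vdash V\triangleright C\multimap\diamond$ infer $\Gamma;\emptyset;\emptyset\vdash V\triangleright C\rightarrow\diamond$. EProm: from $\Gamma;\Lambda,x:C\multimap\diamond;\Delta\vdash P\triangleright\diamond$ infer $\Gamma,x:C\rightarrow\diamond;\Lambda;\Delta\vdash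 P\triangleright\diamond$ (likewise for values). - Abs: from $\Gamma;\Lambda;\Delta_1\vdash P\triangleright\diamond$ and $\Gamma;\emptyset;\Delta_2\vdash x\triangleright C$ infer $\Gamma\setminus x;\Lambda;\Delta_1\setminus\Delta_2\vdash\lambda x.P\triangleright C\multimap\diamond$. App: from $\Gamma;\Lambda;\Delta_1\vdash V\triangleright C\leadsto\diamond$ and $\Gamma;\emptyset;\Delta_2\vdash u\triangleright C$ infer $\Gamma;\Lambda;\Delta_1,\Delta_2\vdash V\,u\triangleright\diamond$. - Send: from $u:S\in\Delta_1,\Delta_2$, $\Gamma;\Lambda_1;\Delta_1\vdash P\triangleright\diamond$, $\Gamma;\Lambda_2;\Delta_2\vdash V\triangleright U$ infer $\Gamma;\Lambda_1,\Lambda_2;((\Delta_1,\Delta_2)\setminus u:S),u:!\langle U\rangle;S\vdash u!\langle V\rangle.P\triangleright\diamond$. - Rcv: from $\Gamma;\Lambda_1;\Delta,u:S\vdash P\triangleright\diamond$ and $\Gamma;\Lambda_2;\emptyset\vdash x\triangleright U$ infer $\Gamma\setminus x;\Lambda_1\setminus\Lambda_2;\Delta,u:?(U);S\vdash u?(x).P\triangleright\diamond$. - Req: from $\Gamma;\emptyset;\emptyset\vdash u\triangleright\langle U\rangle$, $\Gamma;\Lambda;\Delta_1\vdash P\triangleright\diamond$, $\Gamma;\emptyset;\Delta_2\vdash V\triangleright U$ infer $\Gamma;\Lambda;\Delta_1,\Delta_2\vdash u!\langle V\rangle.P\triangleright\diamond$. Acc: from $\Gamma;\emptyset;\emptyset\vdash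 u\triangleright\langle U\rangle$, $\Gamma;\Lambda_1;\Delta\vdash P\triangleright\diamond$, $\Gamma;\Lambda_2;\emptyset\vdash x\triangleright U$ infer $\Gamma\setminus x;\Lambda_1\setminus\Lambda_2;\Delta\vdash u?(x).P\triangleright\diamond$. - Par: from $\Gamma;\Lambda_i;\Delta_i\vdash P_i\triangleright\diamond$ ($i=1,2$) infer $\Gamma;\Lambda_1,\Lambda_2;\Delta_1,\Delta_2\vdash P_1\mid P_2\triangleright\diamond$. End: from $\Gamma;\Lambda;\Delta\vdash P\triangleright\diamond$, $u\notin\mathrm{dom}(\Gamma,\Lambda,\Delta)$ infer $\Gamma;\Lambda;\Delta,u:\mathsf{end}\vdash P\triangleright\diamond$. Res: from $\Gamma,a:\langle U\rangle;\Lambda;\Delta\vdash P\triangleright\diamond$ infer $\Gamma;\Lambda;\Delta\vdash(\nu a)P\triangleright\diamond$. ResS: from $\Gamma;\Lambda;\Delta,s:S_1,\overline s:S_2\vdash P\triangleright\diamond$ with $S_1\ \mathsf{dual}\ S_2$ infer $\Gamma;\Lambda;\Delta\vdash(\nu s)P\triangleright\diamond$. The minimal type system is the same (polyadic) system with all types restricted to minimal ones. **Type decomposition $\mathcal G$** (session types go to lists of minimal session types): $\mathcal G(!\langle U\rangle;S)$ is $!\langle\mathcal G(U)\rangle;\mathsf{end}$ if $S=\mathsf{end}$ and $!\langle\mathcal G(U)\rangle;\mathsf{end},\ \mathcal G(S)$ otherwise; $\mathcal G(?(U);S)$ is $?(\mathcal G(U));\mathsf{end}$ if $S=\mathsf{end}$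 and $?(\mathcal G(U));\mathsf{end},\ \mathcal G(S)$ otherwise; $\mathcal G(\mathsf{end})=\mathsf{end}$; $\mathcal G(C\multimap\diamond)=\mathcal G(C)\multimap\diamond$; $\mathcal G(C\rightarrow\diamond)=\mathcal G(C)\rightarrow\diamond$; $\mathcal G(\langle U\rangle)=\langle\mathcal G(U)\rangle$; $\mathcal G(S_1,\dots,S_n)=\mathcal G(S_1),\dots,\mathcal G(S_n)$. $|\mathcal G(C)|$ is the list length. On environments: $\mathcal G(\emptyset)=\emptyset$; $\mathcal G(\Delta,u_i:S)=\mathcal G(\Delta),(u_i,\dots,u_{i+|\mathcal G(S)|-1}):\mathcal G(S)$; $\mathcal G(\Gamma,u_i:\langle U\rangle)=\mathcal G(\Gamma),u_i:\mathcal G(\langle U\rangle)$; $\mathcal G(\Gamma,x:U)=\mathcal G(\Gamma),x:\mathcal G(U)$; $\mathcal G(\Lambda,x:U)=\mathcal G(\Lambda),x:\mathcal G(U)$. **Indexed names.** $\mathsf{init}(a,b,s,s',\dots)=(a_1,b_1,s_1,s'_1,\dots)$. A process is initialized if all its names carry an index. **Degree.** $|u_i!\langle V\rangle.Q|=|V|+|Q|+1$; $|u_i?(y).Q|=|Q|+1$; $|V\,u_i|=|V|+1$; $|(\nu s:C)P'|=|P'|$; $|Q\mid R|=|Q|+|R|+1$; $|\mathbf 0|=1$; for values $|\lambda x:C^{\multimap}.P|=|P|$, $|\lambda x:C^{\rightarrow}.P|=0$, $|y|=0$. **Breakdown.** Propagators $c_k,c_{k+1},\dots$ are reserved session names. When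 $\widetilde x=\epsilon$, the prefix $c_k?()$ means $c_k?(x)$ and $\overline{c_k}!\langle\rangle$ means $\overline{c_k}!\langle\lambda x.\mathbf 0\rangle$, with types $?(\mathsf{end}\rightarrow\diamond);\mathsf{end}$ and $!\langle\mathsf{end}\rightarrow\diamond\rangle;\mathsf{end}$. For $k>0$ and a tuple of variables $\widetilde x$ (the context; higher-order variables only, name variables being treated as indexed names), using type information: - $\mathcal B_k^{\tilde x}(u_i!\langle V\rangle.Q)=c_k?(\widetilde x).u_i!\langle\mathcal V_{k+1}^{\tilde y}(V\sigma)\rangle.\overline{c_{k+l+1}}!\langle\widetilde z\rangle\mid\mathcal B_{k+l+1}^{\tilde z}(Q\sigma)$, with $\widetilde y=\mathtt{fv}(V)$, $\widetilde z=\mathtt{fv}(Q)$, $l=|V|$, and $\sigma=\{u_{i+1}/u_i\}$ if $u_i$ has a session type, $\sigma=\{\}$ otherwise. - $\mathcal B_k^{\tilde x}(u_i?(y).Q)=c_k?(\widetilde x).u_i?(y).\overline{c_{k+1}}!\langle\widetilde x'\rangle\mid\mathcal B_{k+1}^{\tilde x'}(Q\sigma)$, with $\widetilde x'=\mathtt{fv}(Q)$, $\sigma$ as before. - $\mathcal B_k^{\tilde x}(V\,u_i)=c_k?(\widetilde x).(\mathcal V_{k+1}^{\tilde x}(V)\,\widetilde m)$, with $u_i:C$, $\widetilde x=\mathtt{fv}(V)$, $\widetilde m=(u_i,\dots,u_{i+|\mathcal G(C)|-1})$. - $\mathcal B_k^{\tilde x}((\nu s:C)P')=(\nu\widetilde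 s:\mathcal G(C))\mathcal B_k^{\tilde x}(P'\sigma)$, with $\widetilde x=\mathtt{fv}(P')$, $\widetilde s=(s_1,\dots,s_{|\mathcal G(C)|})$, $\sigma=\{s_1\overline{s_1}/s\overline s\}$ if $C$ is a session type, $\sigma=\{s_1/s\}$ if $C=\langle U\rangle$. - $\mathcal B_k^{\tilde x}(Q\mid R)=c_k?(\widetilde x).\overline{c_{k+1}}!\langle\widetilde y\rangle.\overline{c_{k+l+1}}!\langle\widetilde z\rangle\mid\mathcal B_{k+1}^{\tilde y}(Q)\mid\mathcal B_{k+l+1}^{\tilde z}(R)$, with $\widetilde y=\mathtt{fv}(Q)$, $\widetilde z=\mathtt{fv}(R)$, $l=|Q|$. - $\mathcal B_k^{\tilde x}(\mathbf 0)=c_k?().\mathbf 0$. - $\mathcal V_k^{\tilde x}(y)=y$. - $\mathcal V_k^{\tilde x}(\lambda y:C^{\leadsto}.P)=\lambda\widetilde y:\mathcal G(C)^{\leadsto}.(\nu\widetilde c)(\overline{c_k}!\langle\widetilde x\rangle\mid\mathcal B_k^{\tilde x}(P\{y_1/y\}))$, with $\widetilde x$ the free variables of the abstraction, $\widetilde y=(y_1,\dots,y_{|\mathcal G(C)|})$, $\widetilde c=\epsilon$ if $\leadsto=\multimap$ and $\widetilde c=(c_k,\dots,c_{k+|P|-1})$ if $\leadsto=\rightarrow$. **Decomposition.** For closed $P$ with $\widetilde u=\mathtt{fn}(P)$: $\mathcal D(P)=(\nu\widetilde c)(\overline{c_k}!\langle\rangle.\mathbf 0\mid\mathcal B_k^{\epsilon}(P\sigma))$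 with $k>0$, $\widetilde c=(c_k,\dots,c_{k+|P|-1})$, $\sigma=\{\mathsf{init}(\widetilde u)/\widetilde u\}$.
   Formalization: Adds the hypothesis that no name occurs in P after the last communication of its session type; otherwise the claim fails, e.g. s!⟨λy:end^→.0⟩.((λz:end^⊸.0) s), where the breakdown uses s₂ but 𝒢(!⟨U⟩;end) types only s₁. -}

module Defs where

open import Data.Bool using (if_then_else_)
open import Data.List using (List; []; _∷_; _++_; map; filter; length; head; drop; upTo; foldr)
open import Data.List.Membership.Propositional using (_∈_; _∉_)
import Data.List.Membership.DecPropositional as DecMembership
open import Data.List.Relation.Unary.All using (All)
open import Data.Maybe using (Maybe; just; nothing; _>>=_)
import Data.Maybe as Maybe
import Data.Maybe.Relation.Unary.All as MaybeAll
open import Data.Nat using (ℕ; suc; _+_; _∸_; _≤ᵇ_; _≡ᵇ_)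
import Data.Nat as ℕ
open import Data.Product using (_×_; _,_)
open import Data.Sum using (_⊎_)
open import Data.Unit using (⊤)
open import Relation.Binary.Definitions using (DecidableEquality)
open import Relation.Binary.PropositionalEquality using (_≡_; _≢_; refl)
open import Relation.Nullary using (Dec; yes; no; does; ¬?)
open import Relation.Nullary.Decidable using (map′)

infix 4 _⊑ˢ_ _#_∣_
infix 4 _∣_⊢ⁿ_▷_ _∣_∣_⊢ᵛ_▷_ _∣_∣_⊢_
infix 4 _∣_⊢ᵐⁿ_▷_ _∣_∣_⊢ᵐᵛ_▷_ _∣_⊢ᵐⁿ⋆_▷_ _∣_∣_⊢ᵐᵛ⋆_▷_ _∣_∣_⊢ᵐ_
infixr 6 _∥_

-- Environments are partial maps, so exchange is built in, and all
-- operations on them are stated as pointwise relations.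

Env : Set → Set → Set
Env K A = K → Maybe A

∅ : {K A : Set} → Env K A
∅ _ = nothing

data Split {A : Set} : Maybe A → Maybe A → Maybe A → Set where
  left  : ∀ {m} → Split m m nothing
  right : ∀ {m} → Split m nothing m

module _ {K A : Set} where

  infix 4 _≐∅ _≐_⊕_∶_ _≐_∖_ _≐_∖∖_ _≐_⊞_ _⊑_

  _≐∅ : Env K A → Set
  Δ ≐∅ = ∀ k → Δ k ≡ nothing

  -- Δ is "Δ₀ , u : a", which presupposes u ∉ dom Δ₀.
  record _≐_⊕_∶_ (Δ Δ₀ : Env K A) (u : K) (a : A) : Set where
    field
      fresh : Δ₀ u ≡ nothing
      here  : Δ u ≡ just a
      there : ∀ v → v ≢ u → Δ v ≡ Δ₀ v

  record _≐_∖_ (Δ Δ₀ : Env K A) (u : K) : Set where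
    field
      gone : Δ u ≡ nothing
      kept : ∀ v → v ≢ u → Δ v ≡ Δ₀ v

  record _≐_∖∖_ (Δ Δ₀ : Env K A) (us : List K) : Set where
    field
      gone : ∀ v → v ∈ us → Δ v ≡ nothing
      kept : ∀ v → v ∉ us → Δ v ≡ Δ₀ v

  -- Δ is "Δ₁ , Δ₂" for Δ₁ and Δ₂ with disjoint domains; equivalently, Δ₁
  -- is "Δ \ Δ₂" for Δ₂ contained in Δ.
  _≐_⊞_ : Env K A → Env K A → Env K A → Set
  Δ ≐ Δ₁ ⊞ Δ₂ = ∀ k → Split (Δ k) (Δ₁ k) (Δ₂ k)

  _⊑_ : Env K A → Env K A → Set
  Δ₁ ⊑ Δ₂ = ∀ k a → Δ₁ k ≡ just a → Δ₂ k ≡ just a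

-- The shared environment Γ: its part on higher-order variables (an entry A
-- stands for the type A→⋄) and its part on names and name variables (an
-- entry U stands for the type ⟨U⟩).
record Shared (X A N U : Set) : Set where
  constructor ⟨_⨾_⟩
  field
    vars  : Env X A
    chans : Env N U

open Shared public

_⊑ˢ_ : ∀ {X A N U} → Shared X A N U → Shared X A N U → Set
Γ₁ ⊑ˢ Γ₂ = vars Γ₁ ⊑ vars Γ₂ × chans Γ₁ ⊑ chans Γ₂

-- The domains of Γ, Λ, Δ are pairwise disjoint (those of Λ and Δ always are).
_#_∣_ : ∀ {X A N U S} → Shared X A N U → Env X A → Env N S → Set
Γ # Λ ∣ Δ =
  (∀ x → vars Γ x ≡ nothing ⊎ Λ x ≡ nothing) ×
  (∀ u → chans Γ u ≡ nothing ⊎ Δ u ≡ nothing)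

data Mult : Set where
  lin unr : Mult

mutual
  data UTy : Set where
    fun : Mult → CTy → UTy

  data CTy : Set where
    sess : STy → CTy
    chan : UTy → CTy

  data STy : Set where
    end : STy
    !_⨾_ : UTy → STy → STy
    ¿_⨾_ : UTy → STy → STy

pattern _⊸⋄ C = fun lin C
pattern _→⋄ C = fun unr C

dual : STy → STy
dual end = end
dual (! U ⨾ S) = ¿ U ⨾ dual S
dual (¿ U ⨾ S) = ! U ⨾ dual S

-- The two endpoints s and s̄ of a session.
data Pol : Set where
  pos neg : Pol

-- Shared names, session names, and name variables: what u, w range over.
data Ident : Set where
  shr  : ℕ → Ident
  ses  : Pol → ℕ → Ident
  nvar : ℕ → Ident

-- Higher-order variables; name variables are the nvar y of Ident.
Var : Set
Var = ℕ

mutual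
  data Val : Set where
    var : Var → Val
    lam : (y : ℕ) → CTy → Mult → Proc → Val         -- λy:C^⇝.P, binds nvar y

  data Proc : Set where
    out  : Ident → Val → Proc → Proc
    inp  : Ident → Var → Proc → Proc
    app  : Val → Ident → Proc
    _∥_  : Proc → Proc → Proc
    νˢ   : (s : ℕ) → STy → Proc → Proc               -- (νs:S)P, binds ses pos s and ses neg s
    νᵃ   : (a : ℕ) → UTy → Proc → Proc               -- (νa:⟨U⟩)P, binds shr a
    nil  : Proc

_≟ᴾ_ : DecidableEquality Pol
pos ≟ᴾ pos = yes refl
pos ≟ᴾ neg = no λ ()
neg ≟ᴾ pos = no λ ()
neg ≟ᴾ neg = yes refl

_≟_ : DecidableEquality Ident
shr a ≟ shr b = map′ (λ { refl → refl }) (λ { refl → refl }) (a ℕ.≟ b)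
shr _ ≟ ses _ _ = no λ ()
shr _ ≟ nvar _ = no λ ()
ses _ _ ≟ shr _ = no λ ()
ses p s ≟ ses q t with p ≟ᴾ q | s ℕ.≟ t
... | yes refl | yes refl = yes refl
... | yes refl | no s≢t = no λ { refl → s≢t refl }
... | no p≢q | _ = no λ { refl → p≢q refl }
ses _ _ ≟ nvar _ = no λ ()
nvar _ ≟ shr _ = no λ ()
nvar _ ≟ ses _ _ = no λ ()
nvar x ≟ nvar y = map′ (λ { refl → refl }) (λ { refl → refl }) (x ℕ.≟ y)

open DecMembership ℕ._≟_ using () renaming (_∈?_ to _∈ᵛ?_)
open DecMembership _≟_ using () renaming (_∈?_ to _∈ⁿ?_)

-- Free higher-order variables, without repetitions: these lists are the
-- tuples carried by the propagators.

_∪_ : List Var → List Var → List Var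
xs ∪ ys = xs ++ filter (λ y → ¬? (y ∈ᵛ? xs)) ys

mutual
  fhvᵛ : Val → List Var
  fhvᵛ (var x) = x ∷ []
  fhvᵛ (lam _ _ _ P) = fhv P

  fhv : Proc → List Var
  fhv (out _ V P) = fhvᵛ V ∪ fhv P
  fhv (inp _ x P) = filter (λ y → ¬? (y ℕ.≟ x)) (fhv P)
  fhv (app V _) = fhvᵛ V
  fhv (P ∥ Q) = fhv P ∪ fhv Q
  fhv (νˢ _ _ P) = fhv P
  fhv (νᵃ _ _ P) = fhv P
  fhv nil = []

_without_ : List Ident → Ident → List Ident
us without u = filter (λ v → ¬? (v ≟ u)) us

mutual
  fidᵛ : Val → List Ident
  fidᵛ (var _) = []
  fidᵛ (lam y _ _ P) = fid P without nvar y

  fid : Proc → List Ident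
  fid (out u V P) = u ∷ fidᵛ V ++ fid P
  fid (inp u _ P) = u ∷ fid P
  fid (app V u) = u ∷ fidᵛ V
  fid (P ∥ Q) = fid P ++ fid Q
  fid (νˢ s _ P) = (fid P without ses pos s) without ses neg s
  fid (νᵃ a _ P) = fid P without shr a
  fid nil = []

data IsName : Ident → Set where
  shr : ∀ {a} → IsName (shr a)
  ses : ∀ {p s} → IsName (ses p s)

isName? : ∀ u → Dec (IsName u)
isName? (shr _) = yes shr
isName? (ses _ _) = yes ses
isName? (nvar _) = no λ ()

fn : Proc → List Ident
fn P = filter isName? (fid P)

Closed : Proc → Set
Closed P = fhv P ≡ [] × All IsName (fid P)

SharedEnv : Set
SharedEnv = Shared Var CTy Ident UTy

-- In Λ an entry C stands for the type C⊸⋄.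
LinEnv : Set
LinEnv = Env Var CTy

SessEnv : Set
SessEnv = Env Ident STy

-- Γ;∅;Δ ⊢ u ▷ C
data _∣_⊢ⁿ_▷_ (Γ : SharedEnv) (Δ : SessEnv) : Ident → CTy → Set where
  Sess : ∀ {u S} →
    Δ ≐ ∅ ⊕ u ∶ S →
    chans Γ u ≡ nothing →
    Γ ∣ Δ ⊢ⁿ u ▷ sess S
  Sh : ∀ {u U} →
    chans Γ u ≡ just U →
    Δ ≐∅ →
    Γ ∣ Δ ⊢ⁿ u ▷ chan U

mutual

  -- The annotation of an abstraction records the type it is given.  Hence
  -- Abs concludes with the annotation ⊸, and Prom, which is split according
  -- to the shape of the value, turns it into →.
  data _∣_∣_⊢ᵛ_▷_ : SharedEnv → LinEnv → SessEnv → Val → UTy → Set where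
    LVar : ∀ {Γ Λ Δ x C} →
      Λ ≐ ∅ ⊕ x ∶ C →
      Δ ≐∅ →
      vars Γ x ≡ nothing →
      Γ ∣ Λ ∣ Δ ⊢ᵛ var x ▷ C ⊸⋄
    Prom-var : ∀ {Γ Λ Δ x C} →
      Λ ≐∅ →
      Δ ≐∅ →
      Γ ∣ Λ ∣ Δ ⊢ᵛ var x ▷ C ⊸⋄ →
      Γ ∣ Λ ∣ Δ ⊢ᵛ var x ▷ C →⋄
    Prom-lam : ∀ {Γ Λ Δ y C P} →
      Λ ≐∅ →
      Δ ≐∅ →
      Γ ∣ Λ ∣ Δ ⊢ᵛ lam y C lin P ▷ C ⊸⋄ →
      Γ ∣ Λ ∣ Δ ⊢ᵛ lam y C unr P ▷ C →⋄
    EProm : ∀ {X X₀ N Λ Λ₀ Δ V U x C} →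
      X ≐ X₀ ⊕ x ∶ C →
      Λ₀ ≐ Λ ⊕ x ∶ C →
      ⟨ X₀ ⨾ N ⟩ ∣ Λ₀ ∣ Δ ⊢ᵛ V ▷ U →
      ⟨ X ⨾ N ⟩ ∣ Λ ∣ Δ ⊢ᵛ V ▷ U
    Abs : ∀ {X N N₁ Λ Δ Δ₁ Δ₂ y C P} →
      ⟨ X ⨾ N₁ ⟩ ∣ Λ ∣ Δ₁ ⊢ P →
      ⟨ X ⨾ N₁ ⟩ ∣ Δ₂ ⊢ⁿ nvar y ▷ C →
      N ≐ N₁ ∖ nvar y →
      Δ₁ ≐ Δ ⊞ Δ₂ →
      ⟨ X ⨾ N ⟩ ∣ Λ ∣ Δ ⊢ᵛ lam y C lin P ▷ C ⊸⋄
    Weak : ∀ {Γ Γ₀ Λ Δ V U} →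
      Γ₀ ⊑ˢ Γ →
      Γ # Λ ∣ Δ →
      Γ₀ ∣ Λ ∣ Δ ⊢ᵛ V ▷ U →
      Γ ∣ Λ ∣ Δ ⊢ᵛ V ▷ U

  data _∣_∣_⊢_ : SharedEnv → LinEnv → SessEnv → Proc → Set where
    Nil : ∀ {Γ Λ Δ} →
      Λ ≐∅ →
      Δ ≐∅ →
      Γ ∣ Λ ∣ Δ ⊢ nil
    EProm : ∀ {X X₀ N Λ Λ₀ Δ P x C} →
      X ≐ X₀ ⊕ x ∶ C →
      Λ₀ ≐ Λ ⊕ x ∶ C →
      ⟨ X₀ ⨾ N ⟩ ∣ Λ₀ ∣ Δ ⊢ P →
      ⟨ X ⨾ N ⟩ ∣ Λ ∣ Δ ⊢ P
    App : ∀ {Γ Λ Δ Δ₁ Δ₂ V u m C} →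
      Γ ∣ Λ ∣ Δ₁ ⊢ᵛ V ▷ fun m C →
      Γ ∣ Δ₂ ⊢ⁿ u ▷ C →
      Δ ≐ Δ₁ ⊞ Δ₂ →
      Γ ∣ Λ ∣ Δ ⊢ app V u
    Send : ∀ {Γ Λ Λ₁ Λ₂ Δ Δ₀ Δ₁₂ Δ₁ Δ₂ u U S V P} →
      Δ₁₂ ≐ Δ₁ ⊞ Δ₂ →
      Δ₁₂ ≐ Δ₀ ⊕ u ∶ S →
      Γ ∣ Λ₁ ∣ Δ₁ ⊢ P →
      Γ ∣ Λ₂ ∣ Δ₂ ⊢ᵛ V ▷ U →
      Λ ≐ Λ₁ ⊞ Λ₂ →
      Δ ≐ Δ₀ ⊕ u ∶ (! U ⨾ S) →
      Γ ∣ Λ ∣ Δ ⊢ out u V P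
    Rcv : ∀ {X X₁ N Λ Λ₁ Λ₂ Δ Δ₀ Δ₁ Δ₂ u U S x P} →
      Δ₁ ≐ Δ₀ ⊕ u ∶ S →
      ⟨ X₁ ⨾ N ⟩ ∣ Λ₁ ∣ Δ₁ ⊢ P →
      Δ₂ ≐∅ →
      ⟨ X₁ ⨾ N ⟩ ∣ Λ₂ ∣ Δ₂ ⊢ᵛ var x ▷ U →
      X ≐ X₁ ∖ x →
      Λ₁ ≐ Λ ⊞ Λ₂ →
      Δ ≐ Δ₀ ⊕ u ∶ (¿ U ⨾ S) →
      ⟨ X ⨾ N ⟩ ∣ Λ ∣ Δ ⊢ inp u x P
    Req : ∀ {Γ Λ Λ₂ Δ Δ₀ Δ₁ Δ₂ u U V P} →
      Δ₀ ≐∅ →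
      Γ ∣ Δ₀ ⊢ⁿ u ▷ chan U →
      Γ ∣ Λ ∣ Δ₁ ⊢ P →
      Λ₂ ≐∅ →
      Γ ∣ Λ₂ ∣ Δ₂ ⊢ᵛ V ▷ U →
      Δ ≐ Δ₁ ⊞ Δ₂ →
      Γ ∣ Λ ∣ Δ ⊢ out u V P
    Acc : ∀ {X X₁ N Λ Λ₁ Λ₂ Δ Δ₀ Δ₂ u U x P} →
      Δ₀ ≐∅ →
      ⟨ X₁ ⨾ N ⟩ ∣ Δ₀ ⊢ⁿ u ▷ chan U →
      ⟨ X₁ ⨾ N ⟩ ∣ Λ₁ ∣ Δ ⊢ P →
      Δ₂ ≐∅ →
      ⟨ X₁ ⨾ N ⟩ ∣ Λ₂ ∣ Δ₂ ⊢ᵛ var x ▷ U →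
      X ≐ X₁ ∖ x →
      Λ₁ ≐ Λ ⊞ Λ₂ →
      ⟨ X ⨾ N ⟩ ∣ Λ ∣ Δ ⊢ inp u x P
    Par : ∀ {Γ Λ Λ₁ Λ₂ Δ Δ₁ Δ₂ P Q} →
      Γ ∣ Λ₁ ∣ Δ₁ ⊢ P →
      Γ ∣ Λ₂ ∣ Δ₂ ⊢ Q →
      Λ ≐ Λ₁ ⊞ Λ₂ →
      Δ ≐ Δ₁ ⊞ Δ₂ →
      Γ ∣ Λ ∣ Δ ⊢ P ∥ Q
    End : ∀ {Γ Λ Δ Δ₀ u P} →
      Γ ∣ Λ ∣ Δ₀ ⊢ P →
      chans Γ u ≡ nothing →
      Δ ≐ Δ₀ ⊕ u ∶ end →
      Γ ∣ Λ ∣ Δ ⊢ P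
    Res : ∀ {X N N₁ Λ Δ a U P} →
      N₁ ≐ N ⊕ shr a ∶ U →
      ⟨ X ⨾ N₁ ⟩ ∣ Λ ∣ Δ ⊢ P →
      ⟨ X ⨾ N ⟩ ∣ Λ ∣ Δ ⊢ νᵃ a U P
    ResS : ∀ {Γ Λ Δ Δ₁ Δ₂ s S P} →
      Δ₁ ≐ Δ ⊕ ses pos s ∶ S →
      Δ₂ ≐ Δ₁ ⊕ ses neg s ∶ dual S →
      Γ ∣ Λ ∣ Δ₂ ⊢ P →
      Γ ∣ Λ ∣ Δ ⊢ νˢ s S P
    Weak : ∀ {Γ Γ₀ Λ Δ P} →
      Γ₀ ⊑ˢ Γ →
      Γ # Λ ∣ Δ →
      Γ₀ ∣ Λ ∣ Δ ⊢ P →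
      Γ ∣ Λ ∣ Δ ⊢ P

mutual
  data UTyᵐ : Set where
    fun : Mult → List CTyᵐ → UTyᵐ

  data CTyᵐ : Set where
    sess : STyᵐ → CTyᵐ
    chan : UTyᵐ → CTyᵐ

  data STyᵐ : Set where
    end : STyᵐ
    !⟨_⟩⨾end : List UTyᵐ → STyᵐ
    ¿⟨_⟩⨾end : List UTyᵐ → STyᵐ

dualᵐ : STyᵐ → STyᵐ
dualᵐ end = end
dualᵐ !⟨ Us ⟩⨾end = ¿⟨ Us ⟩⨾end
dualᵐ ¿⟨ Us ⟩⨾end = !⟨ Us ⟩⨾end

-- idx u i is the indexed name uᵢ, where i = 0 means that u carries no index;
-- prp pos k and prp neg k are the propagators cₖ and c̄ₖ.
data Identᵐ : Set where
  idx : Ident → ℕ → Identᵐ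
  prp : Pol → ℕ → Identᵐ

data SNameᵐ : Set where
  idx : (s i : ℕ) → SNameᵐ
  prp : (k : ℕ) → SNameᵐ

endpoint : Pol → SNameᵐ → Identᵐ
endpoint p (idx s i) = idx (ses p s) i
endpoint p (prp k) = prp p k

-- dummy is the variable x in the abbreviation cₖ?() = cₖ?(x).
data Varᵐ : Set where
  src   : Var → Varᵐ
  dummy : Varᵐ

NVarᵐ : Set
NVarᵐ = ℕ × ℕ

nvarᵐ : NVarᵐ → Identᵐ
nvarᵐ (y , i) = idx (nvar y) i

mutual
  data Valᵐ : Set where
    var : Varᵐ → Valᵐ
    lam : List NVarᵐ → List CTyᵐ → Mult → Procᵐ → Valᵐ

  data Procᵐ : Set where
    out  : Identᵐ → List Valᵐ → Procᵐ → Procᵐ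
    inp  : Identᵐ → List Varᵐ → Procᵐ → Procᵐ
    app  : Valᵐ → List Identᵐ → Procᵐ
    _∥_  : Procᵐ → Procᵐ → Procᵐ
    νˢ   : SNameᵐ → Maybe STyᵐ → Procᵐ → Procᵐ       -- the annotation may be omitted
    νᵃ   : (a : ℕ) (i : ℕ) → UTyᵐ → Procᵐ → Procᵐ
    nil  : Procᵐ

SharedEnvᵐ : Set
SharedEnvᵐ = Shared Varᵐ (List CTyᵐ) Identᵐ UTyᵐ

LinEnvᵐ : Set
LinEnvᵐ = Env Varᵐ (List CTyᵐ)

SessEnvᵐ : Set
SessEnvᵐ = Env Identᵐ STyᵐ

data _∣_⊢ᵐⁿ_▷_ (Γ : SharedEnvᵐ) (Δ : SessEnvᵐ) : Identᵐ → CTyᵐ → Set where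
  Sess : ∀ {u S} →
    Δ ≐ ∅ ⊕ u ∶ S →
    chans Γ u ≡ nothing →
    Γ ∣ Δ ⊢ᵐⁿ u ▷ sess S
  Sh : ∀ {u U} →
    chans Γ u ≡ just U →
    Δ ≐∅ →
    Γ ∣ Δ ⊢ᵐⁿ u ▷ chan U

data _∣_⊢ᵐⁿ⋆_▷_ (Γ : SharedEnvᵐ) (Δ : SessEnvᵐ) : List Identᵐ → List CTyᵐ → Set where
  [] :
    Δ ≐∅ →
    Γ ∣ Δ ⊢ᵐⁿ⋆ [] ▷ []
  cons : ∀ {Δ₁ Δ₂ u us C Cs} →
    Γ ∣ Δ₁ ⊢ᵐⁿ u ▷ C →
    Γ ∣ Δ₂ ⊢ᵐⁿ⋆ us ▷ Cs →
    Δ ≐ Δ₁ ⊞ Δ₂ →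
    Γ ∣ Δ ⊢ᵐⁿ⋆ u ∷ us ▷ C ∷ Cs

mutual

  data _∣_∣_⊢ᵐᵛ_▷_ : SharedEnvᵐ → LinEnvᵐ → SessEnvᵐ → Valᵐ → UTyᵐ → Set where
    LVar : ∀ {Γ Λ Δ x Cs} →
      Λ ≐ ∅ ⊕ x ∶ Cs →
      Δ ≐∅ →
      vars Γ x ≡ nothing →
      Γ ∣ Λ ∣ Δ ⊢ᵐᵛ var x ▷ fun lin Cs
    Prom-var : ∀ {Γ Λ Δ x Cs} →
      Λ ≐∅ →
      Δ ≐∅ →
      Γ ∣ Λ ∣ Δ ⊢ᵐᵛ var x ▷ fun lin Cs →
      Γ ∣ Λ ∣ Δ ⊢ᵐᵛ var x ▷ fun unr Cs
    Prom-lam : ∀ {Γ Λ Δ ys Cs P} →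
      Λ ≐∅ →
      Δ ≐∅ →
      Γ ∣ Λ ∣ Δ ⊢ᵐᵛ lam ys Cs lin P ▷ fun lin Cs →
      Γ ∣ Λ ∣ Δ ⊢ᵐᵛ lam ys Cs unr P ▷ fun unr Cs
    EProm : ∀ {X X₀ N Λ Λ₀ Δ V U x Cs} →
      X ≐ X₀ ⊕ x ∶ Cs →
      Λ₀ ≐ Λ ⊕ x ∶ Cs →
      ⟨ X₀ ⨾ N ⟩ ∣ Λ₀ ∣ Δ ⊢ᵐᵛ V ▷ U →
      ⟨ X ⨾ N ⟩ ∣ Λ ∣ Δ ⊢ᵐᵛ V ▷ U
    Abs : ∀ {X N N₁ Λ Δ Δ₁ Δ₂ ys Cs P} →
      ⟨ X ⨾ N₁ ⟩ ∣ Λ ∣ Δ₁ ⊢ᵐ P →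
      ⟨ X ⨾ N₁ ⟩ ∣ Δ₂ ⊢ᵐⁿ⋆ map nvarᵐ ys ▷ Cs →
      N ≐ N₁ ∖∖ map nvarᵐ ys →
      Δ₁ ≐ Δ ⊞ Δ₂ →
      ⟨ X ⨾ N ⟩ ∣ Λ ∣ Δ ⊢ᵐᵛ lam ys Cs lin P ▷ fun lin Cs
    Weak : ∀ {Γ Γ₀ Λ Δ V U} →
      Γ₀ ⊑ˢ Γ →
      Γ # Λ ∣ Δ →
      Γ₀ ∣ Λ ∣ Δ ⊢ᵐᵛ V ▷ U →
      Γ ∣ Λ ∣ Δ ⊢ᵐᵛ V ▷ U

  data _∣_∣_⊢ᵐᵛ⋆_▷_ : SharedEnvᵐ → LinEnvᵐ → SessEnvᵐ → List Valᵐ → List UTyᵐ → Set where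
    [] : ∀ {Γ Λ Δ} →
      Λ ≐∅ →
      Δ ≐∅ →
      Γ ∣ Λ ∣ Δ ⊢ᵐᵛ⋆ [] ▷ []
    cons : ∀ {Γ Λ Λ₁ Λ₂ Δ Δ₁ Δ₂ V Vs U Us} →
      Γ ∣ Λ₁ ∣ Δ₁ ⊢ᵐᵛ V ▷ U →
      Γ ∣ Λ₂ ∣ Δ₂ ⊢ᵐᵛ⋆ Vs ▷ Us →
      Λ ≐ Λ₁ ⊞ Λ₂ →
      Δ ≐ Δ₁ ⊞ Δ₂ →
      Γ ∣ Λ ∣ Δ ⊢ᵐᵛ⋆ V ∷ Vs ▷ U ∷ Us

  data _∣_∣_⊢ᵐ_ : SharedEnvᵐ → LinEnvᵐ → SessEnvᵐ → Procᵐ → Set where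
    Nil : ∀ {Γ Λ Δ} →
      Λ ≐∅ →
      Δ ≐∅ →
      Γ ∣ Λ ∣ Δ ⊢ᵐ nil
    EProm : ∀ {X X₀ N Λ Λ₀ Δ P x Cs} →
      X ≐ X₀ ⊕ x ∶ Cs →
      Λ₀ ≐ Λ ⊕ x ∶ Cs →
      ⟨ X₀ ⨾ N ⟩ ∣ Λ₀ ∣ Δ ⊢ᵐ P →
      ⟨ X ⨾ N ⟩ ∣ Λ ∣ Δ ⊢ᵐ P
    App : ∀ {Γ Λ Δ Δ₁ Δ₂ V us m Cs} →
      Γ ∣ Λ ∣ Δ₁ ⊢ᵐᵛ V ▷ fun m Cs →
      Γ ∣ Δ₂ ⊢ᵐⁿ⋆ us ▷ Cs →
      Δ ≐ Δ₁ ⊞ Δ₂ →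
      Γ ∣ Λ ∣ Δ ⊢ᵐ app V us
    Send : ∀ {Γ Λ Λ₁ Λ₂ Δ Δ₀ Δ₁₂ Δ₁ Δ₂ u Us Vs P} →
      Δ₁₂ ≐ Δ₁ ⊞ Δ₂ →
      Δ₁₂ ≐ Δ₀ ⊕ u ∶ end →
      Γ ∣ Λ₁ ∣ Δ₁ ⊢ᵐ P →
      Γ ∣ Λ₂ ∣ Δ₂ ⊢ᵐᵛ⋆ Vs ▷ Us →
      Λ ≐ Λ₁ ⊞ Λ₂ →
      Δ ≐ Δ₀ ⊕ u ∶ !⟨ Us ⟩⨾end →
      Γ ∣ Λ ∣ Δ ⊢ᵐ out u Vs P
    Rcv : ∀ {X X₁ N Λ Λ₁ Λ₂ Δ Δ₀ Δ₁ Δ₂ u Us xs P} →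
      Δ₁ ≐ Δ₀ ⊕ u ∶ end →
      ⟨ X₁ ⨾ N ⟩ ∣ Λ₁ ∣ Δ₁ ⊢ᵐ P →
      Δ₂ ≐∅ →
      ⟨ X₁ ⨾ N ⟩ ∣ Λ₂ ∣ Δ₂ ⊢ᵐᵛ⋆ map var xs ▷ Us →
      X ≐ X₁ ∖∖ xs →
      Λ₁ ≐ Λ ⊞ Λ₂ →
      Δ ≐ Δ₀ ⊕ u ∶ ¿⟨ Us ⟩⨾end →
      ⟨ X ⨾ N ⟩ ∣ Λ ∣ Δ ⊢ᵐ inp u xs P
    Req : ∀ {Γ Λ Λ₂ Δ Δ₀ Δ₁ Δ₂ u U V P} →
      Δ₀ ≐∅ →
      Γ ∣ Δ₀ ⊢ᵐⁿ u ▷ chan U →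
      Γ ∣ Λ ∣ Δ₁ ⊢ᵐ P →
      Λ₂ ≐∅ →
      Γ ∣ Λ₂ ∣ Δ₂ ⊢ᵐᵛ V ▷ U →
      Δ ≐ Δ₁ ⊞ Δ₂ →
      Γ ∣ Λ ∣ Δ ⊢ᵐ out u (V ∷ []) P
    Acc : ∀ {X X₁ N Λ Λ₁ Λ₂ Δ Δ₀ Δ₂ u U x P} →
      Δ₀ ≐∅ →
      ⟨ X₁ ⨾ N ⟩ ∣ Δ₀ ⊢ᵐⁿ u ▷ chan U →
      ⟨ X₁ ⨾ N ⟩ ∣ Λ₁ ∣ Δ ⊢ᵐ P →
      Δ₂ ≐∅ →
      ⟨ X₁ ⨾ N ⟩ ∣ Λ₂ ∣ Δ₂ ⊢ᵐᵛ var x ▷ U →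
      X ≐ X₁ ∖ x →
      Λ₁ ≐ Λ ⊞ Λ₂ →
      ⟨ X ⨾ N ⟩ ∣ Λ ∣ Δ ⊢ᵐ inp u (x ∷ []) P
    Par : ∀ {Γ Λ Λ₁ Λ₂ Δ Δ₁ Δ₂ P Q} →
      Γ ∣ Λ₁ ∣ Δ₁ ⊢ᵐ P →
      Γ ∣ Λ₂ ∣ Δ₂ ⊢ᵐ Q →
      Λ ≐ Λ₁ ⊞ Λ₂ →
      Δ ≐ Δ₁ ⊞ Δ₂ →
      Γ ∣ Λ ∣ Δ ⊢ᵐ P ∥ Q
    End : ∀ {Γ Λ Δ Δ₀ u P} →
      Γ ∣ Λ ∣ Δ₀ ⊢ᵐ P →
      chans Γ u ≡ nothing →
      Δ ≐ Δ₀ ⊕ u ∶ end →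
      Γ ∣ Λ ∣ Δ ⊢ᵐ P
    Res : ∀ {X N N₁ Λ Δ a i U P} →
      N₁ ≐ N ⊕ idx (shr a) i ∶ U →
      ⟨ X ⨾ N₁ ⟩ ∣ Λ ∣ Δ ⊢ᵐ P →
      ⟨ X ⨾ N ⟩ ∣ Λ ∣ Δ ⊢ᵐ νᵃ a i U P
    ResS : ∀ {Γ Λ Δ Δ₁ Δ₂ s M S P} →
      MaybeAll.All (_≡ S) M →
      Δ₁ ≐ Δ ⊕ endpoint pos s ∶ S →
      Δ₂ ≐ Δ₁ ⊕ endpoint neg s ∶ dualᵐ S →
      Γ ∣ Λ ∣ Δ₂ ⊢ᵐ P →
      Γ ∣ Λ ∣ Δ ⊢ᵐ νˢ s M P
    Weak : ∀ {Γ Γ₀ Λ Δ P} →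
      Γ₀ ⊑ˢ Γ →
      Γ # Λ ∣ Δ →
      Γ₀ ∣ Λ ∣ Δ ⊢ᵐ P →
      Γ ∣ Λ ∣ Δ ⊢ᵐ P

mutual
  𝒢ᵁ : UTy → UTyᵐ
  𝒢ᵁ (fun m C) = fun m (𝒢ᶜ C)

  𝒢ᶜ : CTy → List CTyᵐ
  𝒢ᶜ (sess S) = map sess (𝒢ˢ S)
  𝒢ᶜ (chan U) = chan (𝒢ᵁ U) ∷ []

  𝒢ˢ : STy → List STyᵐ
  𝒢ˢ end = end ∷ []
  𝒢ˢ (! U ⨾ S) = !⟨ 𝒢ᵁ U ∷ [] ⟩⨾end ∷ 𝒢ᵗ S
  𝒢ˢ (¿ U ⨾ S) = ¿⟨ 𝒢ᵁ U ∷ [] ⟩⨾end ∷ 𝒢ᵗ S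

  -- The contribution of a continuation, which is empty for end.
  𝒢ᵗ : STy → List STyᵐ
  𝒢ᵗ end = []
  𝒢ᵗ S@(! _ ⨾ _) = 𝒢ˢ S
  𝒢ᵗ S@(¿ _ ⨾ _) = 𝒢ˢ S

-- An indexing ρ stands for the substitution {u_(ρ u)/u} on all u.
Indexing : Set
Indexing = Ident → ℕ

-- {init(ũ)/ũ}
init : List Ident → Indexing
init us u = if does (u ∈ⁿ? us) then 1 else 0

-- 𝒢(Γρ)
𝒢Γ : SharedEnv → Indexing → SharedEnvᵐ
𝒢Γ Γ ρ = ⟨ X ⨾ N ⟩
  where
  X : Env Varᵐ (List CTyᵐ)
  X (src x) = Maybe.map 𝒢ᶜ (vars Γ x)
  X dummy = nothing

  N : Env Identᵐ UTyᵐ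
  N (idx u i) = if i ≡ᵇ ρ u then Maybe.map 𝒢ᵁ (chans Γ u) else nothing
  N (prp _ _) = nothing

-- 𝒢(Δρ): if Δ(u) = S, then u_(ρ u + j) gets the j-th element of 𝒢(S).
𝒢Δ : SessEnv → Indexing → SessEnvᵐ
𝒢Δ Δ ρ (idx u i) =
  if ρ u ≤ᵇ i then (Δ u >>= λ S → head (drop (i ∸ ρ u) (𝒢ˢ S))) else nothing
𝒢Δ Δ ρ (prp _ _) = nothing

mutual
  ∣_∣ᵛ : Val → ℕ
  ∣ var _ ∣ᵛ = 0
  ∣ lam _ _ lin P ∣ᵛ = ∣ P ∣
  ∣ lam _ _ unr P ∣ᵛ = 0

  ∣_∣ : Proc → ℕ
  ∣ out _ V P ∣ = ∣ V ∣ᵛ + ∣ P ∣ + 1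
  ∣ inp _ _ P ∣ = ∣ P ∣ + 1
  ∣ app V _ ∣ = ∣ V ∣ᵛ + 1
  ∣ νˢ _ _ P ∣ = ∣ P ∣
  ∣ νᵃ _ _ P ∣ = ∣ P ∣
  ∣ P ∥ Q ∣ = ∣ P ∣ + ∣ Q ∣ + 1
  ∣ nil ∣ = 1

_[_↦_] : {A : Set} → (Ident → A) → Ident → A → (Ident → A)
(f [ u ↦ a ]) v = if does (v ≟ u) then a else f v

-- The type information used by the breakdown: the current type of each name
-- and name variable in scope.
TypeInfo : Set
TypeInfo = Ident → Maybe CTy

info : SharedEnv → SessEnv → TypeInfo
info Γ Δ u with Δ u
... | just S = just (sess S)
... | nothing = Maybe.map chan (chans Γ u)

-- The type information after a communication on u.
advance : TypeInfo → Ident → TypeInfo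
advance E u with E u
... | just (sess (! _ ⨾ S)) = E [ u ↦ just (sess S) ]
... | just (sess (¿ _ ⨾ S)) = E [ u ↦ just (sess S) ]
... | _ = E

-- The substitution {uᵢ₊₁/uᵢ} if u has a session type, and {} otherwise.
next : TypeInfo → Ident → Indexing → Indexing
next E u ρ with E u
... | just (sess _) = ρ [ u ↦ suc (ρ u) ]
... | _ = ρ

bindˢ : ℕ → STy → TypeInfo → TypeInfo
bindˢ s S E = (E [ ses pos s ↦ just (sess S) ]) [ ses neg s ↦ just (sess (dual S)) ]

-- (i, …, i+n-1)
interval : ℕ → ℕ → List ℕ
interval i n = map (i +_) (upTo n)

-- |𝒢(C)| for u : C.
width : TypeInfo → Ident → ℕ
width E u = Maybe.maybe (λ C → length (𝒢ᶜ C)) 0 (E u)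

-- cₖ?(x̃).P
cᵢₙ : ℕ → List Var → Procᵐ → Procᵐ
cᵢₙ k [] P = inp (prp pos k) (dummy ∷ []) P
cᵢₙ k xs@(_ ∷ _) P = inp (prp pos k) (map src xs) P

-- c̄ₖ!⟨x̃⟩.P
cₒᵤₜ : ℕ → List Var → Procᵐ → Procᵐ
cₒᵤₜ k [] P = out (prp neg k) (lam ((0 , 0) ∷ []) (sess end ∷ []) unr nil ∷ []) P
cₒᵤₜ k xs@(_ ∷ _) P = out (prp neg k) (map (λ x → var (src x)) xs) P

-- (ν cₖ, …, cₖ₊ₙ₋₁)P
νᶜ : ℕ → ℕ → Procᵐ → Procᵐ
νᶜ k n P = foldr (λ j → νˢ (prp j) nothing) P (interval k n)

-- (ν sᵢ, sᵢ₊₁, … : M̃)P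
νˢ⋆ : ℕ → ℕ → List STyᵐ → Procᵐ → Procᵐ
νˢ⋆ s i [] P = P
νˢ⋆ s i (M ∷ Ms) P = νˢ (idx s i) (just M) (νˢ⋆ s (suc i) Ms P)

-- ℬ E ρ k x̃ P and 𝒱 E ρ k x̃ V are the breakdowns of Pρ and of Vρ: rather
-- than being applied, the substitutions on names accumulate in ρ.
mutual
  ℬ : TypeInfo → Indexing → ℕ → List Var → Proc → Procᵐ
  ℬ E ρ k xs (out u V Q) =
    cᵢₙ k xs (out (idx u (ρ u)) (𝒱 E′ σ (k + 1) (fhvᵛ V) V ∷ [])
      (cₒᵤₜ (k + l + 1) (fhv Q) nil))
    ∥ ℬ E′ σ (k + l + 1) (fhv Q) Q
    where
    l = ∣ V ∣ᵛ
    E′ = advance E u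
    σ = next E u ρ
  ℬ E ρ k xs (inp u y Q) =
    cᵢₙ k xs (inp (idx u (ρ u)) (src y ∷ []) (cₒᵤₜ (k + 1) (fhv Q) nil))
    ∥ ℬ (advance E u) (next E u ρ) (k + 1) (fhv Q) Q
  ℬ E ρ k xs (app V u) =
    cᵢₙ k xs (app (𝒱 E ρ (k + 1) xs V) (map (idx u) (interval (ρ u) (width E u))))
  ℬ E ρ k xs (νˢ s S P) =
    νˢ⋆ s 1 (𝒢ˢ S) (ℬ (bindˢ s S E) ((ρ [ ses pos s ↦ 1 ]) [ ses neg s ↦ 1 ]) k xs P)
  ℬ E ρ k xs (νᵃ a U P) =
    νᵃ a 1 (𝒢ᵁ U) (ℬ (E [ shr a ↦ just (chan U) ]) (ρ [ shr a ↦ 1 ]) k xs P)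
  ℬ E ρ k xs (Q ∥ R) =
    cᵢₙ k xs (cₒᵤₜ (k + 1) (fhv Q) (cₒᵤₜ (k + l + 1) (fhv R) nil))
    ∥ ℬ E ρ (k + 1) (fhv Q) Q
    ∥ ℬ E ρ (k + l + 1) (fhv R) R
    where
    l = ∣ Q ∣
  ℬ E ρ k xs nil = cᵢₙ k [] nil

  𝒱 : TypeInfo → Indexing → ℕ → List Var → Val → Valᵐ
  𝒱 E ρ k xs (var y) = var (src y)
  𝒱 E ρ k xs (lam y C m P) =
    lam (map (y ,_) (interval 1 (length (𝒢ᶜ C)))) (𝒢ᶜ C) m
      (restrict m (cₒᵤₜ k xs nil ∥ ℬ (E [ nvar y ↦ just C ]) (ρ [ nvar y ↦ 1 ]) k xs P))
    where
    restrict : Mult → Procᵐ → Procᵐ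
    restrict lin R = R
    restrict unr R = νᶜ k ∣ P ∣ R

𝒟 : SharedEnv → SessEnv → ℕ → Proc → Procᵐ
𝒟 Γ Δ k P = νᶜ k ∣ P ∣ (cₒᵤₜ k [] nil ∥ ℬ (info Γ Δ) (init (fn P)) k [] P)

-- A name does not occur any more once the last communication of its session
-- type is done.  The typing rules do not ensure this: the name then has type
-- end, so it can still be the argument of an application.  But
-- 𝒢(!⟨U⟩;end) and 𝒢(?(U);end) have a single element, so the index at which
-- the breakdown passes the name is not in 𝒢(Δσ), nor bound by the breakdown.

DoneAfter : TypeInfo → Ident → Set
DoneAfter E u = advance E u u ≡ just (sess end)

mutual
  NoUseAfterEndᵛ : TypeInfo → Val → Set
  NoUseAfterEndᵛ E (var _) = ⊤
  NoUseAfterEndᵛ E (lam y C _ P) = NoUseAfterEnd (E [ nvar y ↦ just C ]) P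

  NoUseAfterEnd : TypeInfo → Proc → Set
  NoUseAfterEnd E (out u V P) =
    (DoneAfter E u → u ∉ fidᵛ V × u ∉ fid P) ×
    NoUseAfterEndᵛ (advance E u) V × NoUseAfterEnd (advance E u) P
  NoUseAfterEnd E (inp u _ P) =
    (DoneAfter E u → u ∉ fid P) × NoUseAfterEnd (advance E u) P
  NoUseAfterEnd E (app V _) = NoUseAfterEndᵛ E V
  NoUseAfterEnd E (P ∥ Q) = NoUseAfterEnd E P × NoUseAfterEnd E Q
  NoUseAfterEnd E (νˢ s S P) = NoUseAfterEnd (bindˢ s S E) P
  NoUseAfterEnd E (νᵃ a U P) = NoUseAfterEnd (E [ shr a ↦ just (chan U) ]) P
  NoUseAfterEnd E nil = ⊤

{-# OPTIONS --safe #-}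
module Submission where

open import Defs
open import Data.Bool using (true; false; if_then_else_)
open import Data.List
  using (List; []; _∷_; _++_; map; length; applyUpTo; foldr; filter; head; drop)
import Data.List.Membership.DecPropositional as DecMembership
open import Data.List.Membership.Propositional using (_∈_; _∉_)
open import Data.List.Membership.Propositional.Properties
  using (∈-map⁺; ∈-map⁻; ∈-++⁺ˡ; ∈-++⁺ʳ; ∈-++⁻; ∈-filter⁺; ∈-filter⁻)
open import Data.List.Properties
  using (map-∘; length-map; map-++; length-++; ++-assoc; map-applyUpTo; map-upTo)
open import Data.List.Relation.Binary.Subset.Propositional using (_⊆_)
open import Data.List.Relation.Unary.Any using (here; there)
open import Data.Maybe using (Maybe; just; nothing; _<∣>_)
import Data.Maybe as Maybe
import Data.Maybe.Relation.Unary.All as MaybeAll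
open import Data.Nat using (ℕ; suc; _+_; _∸_; _<_; _>_)
import Data.Nat as ℕ
import Data.Nat.Properties as ℕ
open import Data.Product using (_×_; _,_; proj₁; proj₂; Σ-syntax)
open import Data.Sum using (_⊎_; inj₁; inj₂; [_,_])
open import Relation.Binary.Definitions using (DecidableEquality)
open import Relation.Binary.PropositionalEquality
  using (_≡_; _≢_; _≗_; refl; sym; trans; cong; cong₂; subst; subst₂)
open import Relation.Nullary using (yes; no; does; ¬_; ¬?; contradiction)
open import Relation.Nullary.Decidable using (dec-true; dec-false; map′)

-- The proof is by induction on the typing derivation of P.  The session type
-- of u becomes a row of minimal types for u_(ρ u), u_(ρ u + 1), …, and a
-- communication on u removes the first entry of its row.  When that was the
-- last one, nothing is left, although the source still has u : end; this is
-- where NoUseAfterEnd is used.  The propagators c_k, …, c_(k+n-1) of a process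
-- of degree n get a list of n types that is concatenated along the breakdown.
--
-- The minimal derivation treats every higher-order variable as unrestricted:
-- EProm types a variable x of the shared environment also as linear, so Rcv
-- and Acc can bind x in the shared environment even when it is received at a
-- linear type.  Propagators thus carry all variables at types C̃→⋄, and no
-- linear environment has to be split.

-- A component of a breakdown owns the inputs of its propagators from `c_k` on, but the outputs only
-- from `c_(k+1)` on: the output on `c_k` belongs to whatever triggers it. So the endpoints of a
-- propagator usually lie in different components, and the two polarities are divided separately,
-- the outputs one index later than the inputs. The types of propagators can be found along the way
-- because their restrictions carry no annotation.
--
-- EProm, End and Weak do not change the process, so the induction cannot follow its syntax. The
-- minimal derivation needs Weak in many places, and Weak demands disjoint domains, which the other
-- rules do not mention; disjointness is therefore first shown for every source derivation.
--
-- Binders may shadow. Each resets the index of its name to 1; typing makes the name absent from the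
-- session environment outside, so its outer row is empty and the old index is harmless.

open _≐_⊕_∶_ renaming (here to at; there to away)
open _≐_∖_

open DecMembership ℕ._≟_ using () renaming (_∈?_ to _∈ᵛ?_)

private
  variable
    K A B : Set

-- Environments

split-nothing : {m n : Maybe A} → Split nothing m n → m ≡ nothing × n ≡ nothing
split-nothing left = refl , refl
split-nothing right = refl , refl

split-comm : {l m n : Maybe A} → Split l m n → Split l n m
split-comm left = right
split-comm right = left

-- Writing the intermediate part with `_<∣>_` avoids an existential over environments. The cases on
-- `l` only let it reduce.
split-assocˡ : {l m n n₁ n₂ : Maybe A} →
  Split l m n → Split n n₁ n₂ → Split l (m <∣> n₁) n₂ × Split (m <∣> n₁) m n₁
split-assocˡ {l = nothing} left left = left , left
split-assocˡ {l = nothing} left right = left , left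
split-assocˡ {l = just _} left left = left , left
split-assocˡ {l = just _} left right = left , left
split-assocˡ right left = left , right
split-assocˡ right right = right , left

split-assocʳ : {l m n m₁ m₂ : Maybe A} →
  Split l m n → Split m m₁ m₂ → Split l m₁ (m₂ <∣> n) × Split (m₂ <∣> n) m₂ n
split-assocʳ left left = left , left
split-assocʳ {l = nothing} left right = left , left
split-assocʳ {l = just _} left right = right , left
split-assocʳ right left = right , right
split-assocʳ right right = right , right

split-interchange : {l m n m₁ m₂ n₁ n₂ : Maybe A} →
  Split l m n → Split m m₁ m₂ → Split n n₁ n₂ →
  Split l (m₁ <∣> n₁) (m₂ <∣> n₂) × Split (m₁ <∣> n₁) m₁ n₁ × Split (m₂ <∣> n₂) m₂ n₂
split-interchange {l = nothing} left left left = left , left , left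
split-interchange {l = nothing} left left right = left , left , left
split-interchange {l = nothing} left right left = left , left , left
split-interchange {l = nothing} left right right = left , left , left
split-interchange {l = just _} left left left = left , left , left
split-interchange {l = just _} left left right = left , left , left
split-interchange {l = just _} left right left = right , left , left
split-interchange {l = just _} left right right = right , left , left
split-interchange right left left = left , right , left
split-interchange right left right = right , left , right
split-interchange right right left = left , right , left
split-interchange right right right = right , left , right

module _ {K A : Set} where

  private
    variable
      Δ Δ′ Δ₀ Δ₁ Δ₂ : Env K A
      u : K
      a b : A

  ⊞-comm : Δ ≐ Δ₁ ⊞ Δ₂ → Δ ≐ Δ₂ ⊞ Δ₁
  ⊞-comm s v = split-comm (s v)

  ⊞-respˡ : Δ ≗ Δ′ → Δ ≐ Δ₁ ⊞ Δ₂ → Δ′ ≐ Δ₁ ⊞ Δ₂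
  ⊞-respˡ eq s v = subst (λ m → Split m _ _) (eq v) (s v)

  ⊞-lookupˡ : Δ ≐ Δ₁ ⊞ Δ₂ → Δ₁ u ≡ just a → Δ u ≡ just a
  ⊞-lookupˡ {Δ = Δ} {Δ₁} {Δ₂} {u = u} s eq with Δ u | Δ₁ u | Δ₂ u | s u
  ... | _ | _ | _ | left = eq
  ⊞-lookupˡ s () | _ | _ | _ | right

  ⊞-∅ʳ : Δ₂ ≐∅ → Δ ≐ Δ ⊞ Δ₂
  ⊞-∅ʳ e v rewrite e v = left

  ⊞-nothing : Δ ≐ Δ₁ ⊞ Δ₂ → Δ u ≡ nothing → Δ₁ u ≡ nothing
  ⊞-nothing {Δ = Δ} {Δ₁} {Δ₂} {u = u} s eq =
    proj₁ (split-nothing (subst (λ m → Split m (Δ₁ u) (Δ₂ u)) eq (s u)))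

  ⊕-respˡ : Δ ≗ Δ′ → Δ ≐ Δ₀ ⊕ u ∶ a → Δ′ ≐ Δ₀ ⊕ u ∶ a
  ⊕-respˡ eq e .fresh = e .fresh
  ⊕-respˡ {u = u} eq e .at = trans (sym (eq u)) (e .at)
  ⊕-respˡ eq e .away v v≢u = trans (sym (eq v)) (e .away v v≢u)

  ⊕-respʳ : Δ₀ ≗ Δ′ → Δ ≐ Δ₀ ⊕ u ∶ a → Δ ≐ Δ′ ⊕ u ∶ a
  ⊕-respʳ {u = u} eq e .fresh = trans (sym (eq u)) (e .fresh)
  ⊕-respʳ eq e .at = e .at
  ⊕-respʳ eq e .away v v≢u = trans (e .away v v≢u) (eq v)

  ⊞-⊕ : Δ ≐ Δ₁ ⊞ Δ₂ → Δ₂ ≐ ∅ ⊕ u ∶ a → Δ ≐ Δ₁ ⊕ u ∶ a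
  ⊞-⊕ {Δ = Δ} {Δ₁} {Δ₂} {u = u} s e .fresh with Δ u | Δ₁ u | Δ₂ u | s u | e .at
  ... | _ | _ | _ | right | _ = refl
  ⊞-⊕ {u = u} s e .at = ⊞-lookupˡ (⊞-comm s) (e .at)
  ⊞-⊕ {Δ = Δ} {Δ₁} {Δ₂} s e .away v v≢u with Δ v | Δ₁ v | Δ₂ v | s v | e .away v v≢u
  ... | _ | _ | _ | left | _ = refl
  ... | _ | _ | _ | right | eq = eq

module Update (_≟ᴷ_ : DecidableEquality K) where

  update : (K → B) → K → B → K → B
  update f u b v = if does (v ≟ᴷ u) then b else f v

  update-same : (f : K → B) (u : K) {b : B} → update f u b u ≡ b
  update-same f u rewrite dec-true (u ≟ᴷ u) refl = refl

  update-other : (f : K → B) {u v : K} {b : B} → v ≢ u → update f u b v ≡ f v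
  update-other f {u} {v} v≢u rewrite dec-false (v ≟ᴷ u) v≢u = refl

  module _ {Δ : Env K A} {u : K} {a : A} where

    extend : Δ u ≡ nothing → update Δ u (just a) ≐ Δ ⊕ u ∶ a
    extend eq .fresh = eq
    extend eq .at = update-same Δ u
    extend eq .away v = update-other Δ

    remove : Δ u ≡ just a → Δ ≐ update Δ u nothing ⊕ u ∶ a
    remove eq .fresh = update-same Δ u
    remove eq .at = eq
    remove eq .away v v≢u = sym (update-other Δ v≢u)

  module _ {Δ Δ′ Δ₁ Δ₂ : Env K A} {u : K} {a : A} where

    ⊞-extend : Δ ≐ Δ′ ⊕ u ∶ a → Δ′ ≐ Δ₁ ⊞ Δ₂ → Δ ≐ update Δ₁ u (just a) ⊞ Δ₂
    ⊞-extend e s v with v ≟ᴷ u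
    ... | no v≢u rewrite e .away v v≢u = s v
    ... | yes refl
      rewrite e .at | ⊞-nothing (⊞-comm s) (e .fresh) = left

-- Segments

-- Serves twice: for the row of one indexed name, and for the types of consecutive propagators of
-- one polarity.
seg : ℕ → List A → Env ℕ A
seg i [] j = nothing
seg i (x ∷ xs) j = if does (j ℕ.≟ i) then just x else seg (suc i) xs j

seg-below : ∀ {i j} (xs : List A) → j < i → seg i xs j ≡ nothing
seg-below [] _ = refl
seg-below {i = i} {j} (x ∷ xs) j<i
  rewrite dec-false (j ℕ.≟ i) (ℕ.<⇒≢ j<i) = seg-below xs (ℕ.m<n⇒m<1+n j<i)

seg-∷ : ∀ {i} {x : A} {xs} → seg i (x ∷ xs) ≐ seg (suc i) xs ⊕ i ∶ x
seg-∷ {xs = xs} .fresh = seg-below xs (ℕ.n<1+n _)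
seg-∷ {i = i} .at rewrite dec-true (i ℕ.≟ i) refl = refl
seg-∷ {i = i} .away j j≢i rewrite dec-false (j ℕ.≟ i) j≢i = refl

-- The second start is given up to an equation, since indices of the breakdown such as `k + l + 1`
-- do not have the form `length xs + i`.
seg-++ : ∀ {i j} (xs : List A) {ys} → j ≡ length xs + i →
  seg i (xs ++ ys) ≐ seg i xs ⊞ seg j ys
seg-++ [] refl v = right
seg-++ {i = i} (x ∷ xs) {ys} refl v with v ℕ.≟ i
... | no v≢i rewrite dec-false (v ℕ.≟ i) v≢i = seg-++ xs (sym (ℕ.+-suc (length xs) i)) v
... | yes refl rewrite dec-true (v ℕ.≟ v) refl | seg-below {j = v} ys (ℕ.s≤s (ℕ.m≤n+m v (length xs))) = left

seg-[] : ∀ {i} {x : A} → seg i (x ∷ []) ≐ ∅ ⊕ i ∶ x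
seg-[] = seg-∷ {xs = []}

-- The minimal system with unrestricted variables

_≟ᵐ_ : DecidableEquality Identᵐ
idx u i ≟ᵐ idx v j with u ≟ v | i ℕ.≟ j
... | yes refl | yes refl = yes refl
... | yes _ | no i≢j = no λ { refl → i≢j refl }
... | no u≢v | _ = no λ { refl → u≢v refl }
idx _ _ ≟ᵐ prp _ _ = no λ ()
prp _ _ ≟ᵐ idx _ _ = no λ ()
prp p j ≟ᵐ prp q k with p ≟ᴾ q | j ℕ.≟ k
... | yes refl | yes refl = yes refl
... | yes _ | no j≢k = no λ { refl → j≢k refl }
... | no p≢q | _ = no λ { refl → p≢q refl }

_≟ˣ_ : DecidableEquality Varᵐ
src x ≟ˣ src y = map′ (cong src) (λ { refl → refl }) (x ℕ.≟ y)
src _ ≟ˣ dummy = no λ ()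
dummy ≟ˣ src _ = no λ ()
dummy ≟ˣ dummy = yes refl

module Upᴵ = Update _≟_
module Upᵐ = Update _≟ᵐ_
module Upˣ = Update _≟ˣ_

private
  variable
    X Y : Env Varᵐ (List CTyᵐ)
    N N′ : Env Identᵐ UTyᵐ
    Δ Δ′ Δ₁ Δ₂ : SessEnvᵐ
    R : Procᵐ
    V : Valᵐ
    U : UTyᵐ

infix 4 _∣_∣_⊢_ok
_∣_∣_⊢_ok : Env Varᵐ (List CTyᵐ) → Env Identᵐ UTyᵐ → SessEnvᵐ → Procᵐ → Set
X ∣ N ∣ Δ ⊢ R ok = ⟨ X ⨾ N ⟩ ∣ ∅ ∣ Δ ⊢ᵐ R

-- Environments are functions and extensionality is not assumed, so passing to a pointwise equal one
-- means rebuilding the derivation.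
⊢ᵐ-resp : ∀ {Γ Λ Δ Δ′ R} → Δ ≗ Δ′ → Γ ∣ Λ ∣ Δ ⊢ᵐ R → Γ ∣ Λ ∣ Δ′ ⊢ᵐ R
⊢ᵐ-resp eq (Nil e f) = Nil e λ k → trans (sym (eq k)) (f k)
⊢ᵐ-resp eq (EProm x l d) = EProm x l (⊢ᵐ-resp eq d)
⊢ᵐ-resp eq (App v us s) = App v us (⊞-respˡ eq s)
⊢ᵐ-resp eq (Send s e d vs l f) = Send s e d vs l (⊕-respˡ eq f)
⊢ᵐ-resp eq (Rcv e d z vs x l f) = Rcv e d z vs x l (⊕-respˡ eq f)
⊢ᵐ-resp eq (Req z u d l v s) = Req z u d l v (⊞-respˡ eq s)
⊢ᵐ-resp eq (Acc z u d z′ v x l) = Acc z u (⊢ᵐ-resp eq d) z′ v x l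
⊢ᵐ-resp eq (Par d e l s) = Par d e l (⊞-respˡ eq s)
⊢ᵐ-resp eq (End d n e) = End d n (⊕-respˡ eq e)
⊢ᵐ-resp eq (Res e d) = Res e (⊢ᵐ-resp eq d)
⊢ᵐ-resp eq (ResS m e f d) = ResS m (⊕-respʳ eq e) f d
⊢ᵐ-resp eq (Weak s (x , u) d) =
  Weak s (x , λ k → subst (λ m → _ ⊎ m ≡ nothing) (eq k) (u k)) (⊢ᵐ-resp eq d)

var-ok : ∀ {x Cs} m → X x ≡ just Cs → Δ ≐∅ → ⟨ X ⨾ N ⟩ ∣ ∅ ∣ Δ ⊢ᵐᵛ var x ▷ fun m Cs
var-ok {X = X} {x = x} lin eq e =
  EProm (Upˣ.remove eq) (Upˣ.extend refl) (LVar (Upˣ.extend refl) e (Upˣ.update-same X x))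
-- Prom needs an empty linear environment, so it must come after the EProm that empties it.
var-ok unr eq e = Prom-var (λ _ → refl) e (var-ok lin eq e)

-- A minimal communication leaves `u : end` behind, while the breakdown goes on with another index.
-- End supplies that entry, so the continuation is typed without `u`.
receive : ∀ {u xs Us} →
  Δ ≐ Δ′ ⊕ u ∶ ¿⟨ Us ⟩⨾end → N u ≡ nothing →
  X ∣ N ∣ Δ′ ⊢ R ok → ⟨ X ⨾ N ⟩ ∣ ∅ ∣ ∅ ⊢ᵐᵛ⋆ map var xs ▷ Us → Y ≐ X ∖∖ xs →
  Y ∣ N ∣ Δ ⊢ inp u xs R ok
receive e n d vs f =
  Rcv (Upᵐ.extend (e .fresh)) (End d n (Upᵐ.extend (e .fresh))) (λ _ → refl) vs f (λ _ → left) e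

send : ∀ {u Vs Us} →
  Δ ≐ Δ′ ⊕ u ∶ !⟨ Us ⟩⨾end → Δ′ ≐ Δ₁ ⊞ Δ₂ → N u ≡ nothing →
  X ∣ N ∣ Δ₁ ⊢ R ok → ⟨ X ⨾ N ⟩ ∣ ∅ ∣ Δ₂ ⊢ᵐᵛ⋆ Vs ▷ Us →
  X ∣ N ∣ Δ ⊢ out u Vs R ok
send e s n d vs =
  Send (Upᵐ.⊞-extend (Upᵐ.extend (e .fresh)) s) (Upᵐ.extend (e .fresh))
    (End d n (Upᵐ.extend (⊞-nothing s (e .fresh)))) vs (λ _ → left) e

-- Propagators

-- Multiplicities are dropped because propagators carry all variables as unrestricted. The map is
-- total; only its values at variables in scope get constrained.
Typing : Set
Typing = Var → CTy

record Provides (X : Env Varᵐ (List CTyᵐ)) (τ : Typing) (xs : List Var) : Set where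
  constructor provides
  field
    provided : ∀ {x} → x ∈ xs → X (src x) ≡ just (𝒢ᶜ (τ x))

-- Absence matters below a prefix that binds a variable: the receive rules require the bound
-- variable to be missing from the outer environment.
record Exact (X : Env Varᵐ (List CTyᵐ)) (τ : Typing) (xs : List Var) : Set where
  constructor exact
  field
    inside  : Provides X τ xs
    outside : ∀ {x} → x ∉ xs → X (src x) ≡ nothing

open Provides
open Exact

payload : Typing → List Var → List UTyᵐ
payload τ [] = fun unr (sess end ∷ []) ∷ []
payload τ xs@(_ ∷ _) = map (λ x → fun unr (𝒢ᶜ (τ x))) xs

carry : Typing → List Var → STyᵐ
carry τ xs = ¿⟨ payload τ xs ⟩⨾end

vars-ok : ∀ {τ} xs → Provides X τ xs →
  ⟨ X ⨾ N ⟩ ∣ ∅ ∣ ∅ ⊢ᵐᵛ⋆ map (λ x → var (src x)) xs ▷ map (λ x → fun unr (𝒢ᶜ (τ x))) xs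
vars-ok [] _ = [] (λ _ → refl) (λ _ → refl)
vars-ok {τ = τ} (x ∷ xs) p =
  cons (var-ok unr (p .provided (here refl)) (λ _ → refl))
    (vars-ok {τ = τ} xs (provides λ m → p .provided (there m)))
    (λ _ → left) (λ _ → left)

cₒᵤₜ-ok : ∀ {τ k} xs → Provides X τ xs → Δ ≐ Δ′ ⊕ prp neg k ∶ !⟨ payload τ xs ⟩⨾end →
  N (prp neg k) ≡ nothing → X ∣ N ∣ Δ′ ⊢ R ok → X ∣ N ∣ Δ ⊢ cₒᵤₜ k xs R ok
cₒᵤₜ-ok [] p e n d = send e (λ _ → left) n d
  (cons
    (Prom-lam (λ _ → refl) (λ _ → refl)
      -- The bound name `z` may already be a channel of `N`, which would block both Sess and Abs.
      -- The filler abstraction is closed, so it is typed in the empty environment and then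
      -- weakened.
      (Weak {Γ₀ = ⟨ ∅ ⨾ ∅ ⟩} ((λ _ _ ()) , λ _ _ ()) ((λ _ → inj₂ refl) , (λ _ → inj₂ refl))
        (Abs {N₁ = ∅} {Δ₁ = Upᵐ.update ∅ z (just end)}
          (End (Nil (λ _ → refl) (λ _ → refl)) refl (Upᵐ.extend refl))
          (cons (Sess (Upᵐ.extend refl) refl) ([] (λ _ → refl)) (λ _ → left))
          (record { gone = λ _ _ → refl ; kept = λ _ _ → refl })
          (λ _ → right))))
    ([] (λ _ → refl) (λ _ → refl))
    (λ _ → left) (λ _ → left))
  where
  z = nvarᵐ (0 , 0)
cₒᵤₜ-ok xs@(_ ∷ _) p e n d = send e (λ _ → left) n d (vars-ok xs p)

-- Outside the prefix there are no higher-order variables at all: a component gets its whole context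
-- from its propagator. For the empty context the bound variable is `dummy`, which `Exact` does not
-- see.
cᵢₙ-ok : ∀ {τ k} xs → Δ ≐ Δ′ ⊕ prp pos k ∶ carry τ xs → N (prp pos k) ≡ nothing →
  (∀ X → Exact X τ xs → X ∣ N ∣ Δ′ ⊢ R ok) → ∅ ∣ N ∣ Δ ⊢ cᵢₙ k xs R ok
cᵢₙ-ok [] e n d = receive e n (d Z (exact (provides λ ()) λ _ → refl))
  (cons (var-ok unr refl (λ _ → refl)) ([] (λ _ → refl) (λ _ → refl)) (λ _ → left) (λ _ → left))
  (record { gone = λ _ _ → refl ; kept = λ { (src _) _ → refl ; dummy m → contradiction (here refl) m } })
  where
  Z : Env Varᵐ (List CTyᵐ)
  Z (src _) = nothing
  Z dummy = just (sess end ∷ [])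
cᵢₙ-ok {N = N} {τ = τ} xs@(_ ∷ _) e n d = receive e n (d Z (exact in-xs out-xs))
  (subst (λ Vs → ⟨ Z ⨾ N ⟩ ∣ ∅ ∣ ∅ ⊢ᵐᵛ⋆ Vs ▷ payload τ xs) (map-∘ xs) (vars-ok xs in-xs))
  (record { gone = λ _ _ → refl
          ; kept = λ { (src x) m → sym (out-xs (λ m′ → m (∈-map⁺ src m′))) ; dummy _ → refl } })
  where
  Z : Env Varᵐ (List CTyᵐ)
  Z (src x) = if does (x ∈ᵛ? xs) then just (𝒢ᶜ (τ x)) else nothing
  Z dummy = nothing
  in-xs : Provides Z τ xs
  in-xs .provided {x} m rewrite dec-true (x ∈ᵛ? xs) m = refl
  out-xs : ∀ {x} → x ∉ xs → Z (src x) ≡ nothing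
  out-xs {x} m rewrite dec-false (x ∈ᵛ? xs) m = refl

-- Rows of indexed names

-- The names u_(ρ u), u_(ρ u + 1), … have the types L u.  Unlike 𝒢ˢ, which is
-- never empty, L u may be empty: when u is not in the session environment, or
-- when its last communication is done (see Shape).
Rows : Set
Rows = Ident → List STyᵐ

⟦_⟧ : Rows → Indexing → SessEnvᵐ
⟦ L ⟧ ρ (idx u i) = seg (ρ u) (L u) i
⟦ L ⟧ ρ (prp _ _) = nothing

-- Indexed names, propagator inputs and propagator outputs are three independent coordinates, so
-- each can be split in its own way.
join : SessEnvᵐ → Env ℕ STyᵐ → Env ℕ STyᵐ → SessEnvᵐ
join D p n (idx u i) = D (idx u i)
join D p n (prp pos k) = p k
join D p n (prp neg k) = n k

private
  variable
    D D₁ D₂ : SessEnvᵐ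
    p p₁ p₂ n n₁ n₂ : Env ℕ STyᵐ

join-⊞ : D ≐ D₁ ⊞ D₂ → p ≐ p₁ ⊞ p₂ → n ≐ n₁ ⊞ n₂ →
  join D p n ≐ join D₁ p₁ n₁ ⊞ join D₂ p₂ n₂
join-⊞ d _ _ (idx u i) = d (idx u i)
join-⊞ _ p _ (prp pos k) = p k
join-⊞ _ _ n (prp neg k) = n k

join-⊞ⁿ : D ≐ D₁ ⊞ D₂ → (∀ q k → D₂ (prp q k) ≡ nothing) → join D p n ≐ join D₁ p n ⊞ D₂
join-⊞ⁿ d _ (idx u i) = d (idx u i)
join-⊞ⁿ _ e (prp pos k) rewrite e pos k = left
join-⊞ⁿ _ e (prp neg k) rewrite e neg k = left

join-≗ : D ≗ D₁ → p ≗ p₁ → n ≗ n₁ → join D p n ≗ join D₁ p₁ n₁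
join-≗ d _ _ (idx u i) = d (idx u i)
join-≗ _ p _ (prp pos k) = p k
join-≗ _ _ n (prp neg k) = n k

join-≐∅ : D ≐∅ → p ≐∅ → n ≐∅ → join D p n ≐∅
join-≐∅ d _ _ (idx u i) = d (idx u i)
join-≐∅ _ p _ (prp pos k) = p k
join-≐∅ _ _ n (prp neg k) = n k

join-⊕ⁿ : ∀ {u i M} → D ≐ D₁ ⊕ idx u i ∶ M → join D p n ≐ join D₁ p n ⊕ idx u i ∶ M
join-⊕ⁿ e .fresh = e .fresh
join-⊕ⁿ e .at = e .at
join-⊕ⁿ e .away (idx u i) = e .away (idx u i)
join-⊕ⁿ e .away (prp pos k) _ = refl
join-⊕ⁿ e .away (prp neg k) _ = refl

join-⊕⁺ : ∀ {k M} → p ≐ p₁ ⊕ k ∶ M → join D p n ≐ join D p₁ n ⊕ prp pos k ∶ M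
join-⊕⁺ e .fresh = e .fresh
join-⊕⁺ e .at = e .at
join-⊕⁺ e .away (idx u i) _ = refl
join-⊕⁺ e .away (prp pos k) k≢ = e .away k λ { refl → k≢ refl }
join-⊕⁺ e .away (prp neg k) _ = refl

join-⊕⁻ : ∀ {k M} → n ≐ n₁ ⊕ k ∶ M → join D p n ≐ join D p n₁ ⊕ prp neg k ∶ M
join-⊕⁻ e .fresh = e .fresh
join-⊕⁻ e .at = e .at
join-⊕⁻ e .away (idx u i) _ = refl
join-⊕⁻ e .away (prp pos k) _ = refl
join-⊕⁻ e .away (prp neg k) k≢ = e .away k λ { refl → k≢ refl }

private
  variable
    L L′ : Rows
    ρ ρ′ : Indexing

⟦⟧-≐∅ : (∀ u → L u ≡ []) → ⟦ L ⟧ ρ ≐∅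
⟦⟧-≐∅ e (idx u i) rewrite e u = refl
⟦⟧-≐∅ e (prp _ _) = refl

-- The index of an empty row is irrelevant. This covers a channel binder, which resets the index of
-- a name without a row.
⟦⟧-cong : (∀ u → ρ u ≡ ρ′ u × L u ≡ L′ u ⊎ L u ≡ [] × L′ u ≡ []) → ⟦ L ⟧ ρ ≗ ⟦ L′ ⟧ ρ′
⟦⟧-cong e (idx u i) with e u
... | inj₁ (eq , eq′) rewrite eq | eq′ = refl
... | inj₂ (eq , eq′) rewrite eq | eq′ = refl
⟦⟧-cong e (prp _ _) = refl

-- The alternative on `ρ′` has two users: a communication moves the index past the removed entry,
-- while End removes a sole entry and leaves the index alone.
⟦⟧-⊕ : ∀ {u M Ms} → L u ≡ M ∷ Ms → L′ u ≡ Ms → (ρ′ u ≡ suc (ρ u) ⊎ Ms ≡ []) →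
  (∀ v → v ≢ u → L′ v ≡ L v × ρ′ v ≡ ρ v) →
  ⟦ L ⟧ ρ ≐ ⟦ L′ ⟧ ρ′ ⊕ idx u (ρ u) ∶ M
⟦⟧-⊕ {L = L} {L′} {ρ′} {ρ} {u} {M} {Ms} hd tl nx other = record
  { fresh = trans row (seg-∷ {x = M} {xs = Ms} .fresh)
  ; here = trans (cong (λ Ms → seg (ρ u) Ms (ρ u)) hd) (seg-∷ {xs = Ms} .at)
  ; there = off
  }
  where
  shift : ρ′ u ≡ suc (ρ u) ⊎ Ms ≡ [] → seg (ρ′ u) Ms ≗ seg (suc (ρ u)) Ms
  shift (inj₁ eq) i rewrite eq = refl
  shift (inj₂ refl) i = refl
  row : ∀ {i} → seg (ρ′ u) (L′ u) i ≡ seg (suc (ρ u)) Ms i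
  row {i} = trans (cong (λ Ms → seg (ρ′ u) Ms i) tl) (shift nx i)
  off : ∀ w → w ≢ idx u (ρ u) → ⟦ L ⟧ ρ w ≡ ⟦ L′ ⟧ ρ′ w
  off (prp _ _) _ = refl
  off (idx v i) w≢ with v ≟ u
  ... | no v≢u rewrite proj₁ (other v v≢u) | proj₂ (other v v≢u) = refl
  ... | yes refl =
    trans (cong (λ Ms → seg (ρ u) Ms i) hd)
      (trans (seg-∷ {xs = Ms} .away i λ { refl → w≢ refl }) (sym row))

rowOf : CTy → List STyᵐ
rowOf (sess S) = 𝒢ˢ S
rowOf (chan _) = []

single : Ident → ℕ → List STyᵐ → SessEnvᵐ
single u i Ms (idx v j) = if does (v ≟ u) then seg i Ms j else nothing
single u i Ms (prp _ _) = nothing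

single-⊞ : ∀ {u i M Ms} → single u i (M ∷ Ms) ≐ single u i (M ∷ []) ⊞ single u (suc i) Ms
single-⊞ {u} {i} {M} {Ms} (idx v j) with does (v ≟ u)
... | true = seg-++ (M ∷ []) {Ms} refl j
... | false = left
single-⊞ (prp _ _) = left

single-⊕ : ∀ {u i M} → single u i (M ∷ []) ≐ ∅ ⊕ idx u i ∶ M
single-⊕ .fresh = refl
single-⊕ {u} {i} {M} .at rewrite dec-true (u ≟ u) refl = seg-[] {i = i} {M} .at
single-⊕ {u} .away (idx v j) w≢ with v ≟ u
... | yes refl = seg-[] .away j λ { refl → w≢ refl }
... | no _ = refl
single-⊕ .away (prp _ _) _ = refl

single-[] : ∀ {u i} → single u i [] ≐∅
single-[] {u} (idx v j) with does (v ≟ u)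
... | true = refl
... | false = refl
single-[] (prp _ _) = refl

⟦⟧-single : ∀ {u} → (∀ v → v ≢ u → L v ≡ []) → ⟦ L ⟧ ρ ≗ single u (ρ u) (L u)
⟦⟧-single {u = u} e (idx v i) with v ≟ u
... | yes refl = refl
... | no v≢u rewrite e v v≢u = refl
⟦⟧-single e (prp _ _) = refl

-- Since the old row is empty, the environment outside the binder can keep `ρ`, whatever index it
-- gives to `u`.
⟦⟧-bind : ∀ {u i} Ms → L u ≡ [] →
  ⟦ L [ u ↦ Ms ] ⟧ (ρ [ u ↦ i ]) ≐ ⟦ L ⟧ ρ ⊞ single u i Ms
⟦⟧-bind {u = u} Ms e (idx v j) with v ≟ u
... | yes refl rewrite e = right
... | no _ = left
⟦⟧-bind Ms e (prp _ _) = left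

interval-suc : ∀ i n → interval i (suc n) ≡ i ∷ interval (suc i) n
interval-suc i n = cong₂ _∷_ (ℕ.+-identityʳ i)
  (trans (map-applyUpTo suc (i +_) n)
    (sym (trans (map-upTo (suc i +_) n) (applyUpTo-cong (λ j → sym (ℕ.+-suc i j)) n))))
  where
  applyUpTo-cong : {f g : ℕ → A} → f ≗ g → ∀ n → applyUpTo f n ≡ applyUpTo g n
  applyUpTo-cong e ℕ.zero = refl
  applyUpTo-cong e (suc n) = cong₂ _∷_ (e 0) (applyUpTo-cong (λ j → e (suc j)) n)

row-ok : ∀ {u} i Ms → (∀ j → N (idx u j) ≡ nothing) → Δ ≗ single u i Ms →
  ⟨ X ⨾ N ⟩ ∣ Δ ⊢ᵐⁿ⋆ map (idx u) (interval i (length Ms)) ▷ map sess Ms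
row-ok i [] n eq = [] λ w → trans (eq w) (single-[] w)
row-ok {N = N} {Δ} {X} {u} i (M ∷ Ms) n eq =
  subst (λ is → ⟨ X ⨾ N ⟩ ∣ Δ ⊢ᵐⁿ⋆ map (idx u) is ▷ map sess (M ∷ Ms)) (sym (interval-suc i (length Ms)))
    (cons (Sess single-⊕ (n i)) (row-ok (suc i) Ms n (λ _ → refl))
      (⊞-respˡ (λ w → sym (eq w)) single-⊞))

-- Only the channel half of `𝒢Γ` is followed through the induction; the variable half is rebuilt at
-- each propagator.
𝒩 : Env Ident UTy → Indexing → Env Identᵐ UTyᵐ
𝒩 N ρ = chans (𝒢Γ ⟨ ∅ ⨾ N ⟩ ρ)

𝒩-nothing : ∀ {N u i} → N u ≡ nothing → 𝒩 N ρ (idx u i) ≡ nothing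
𝒩-nothing {ρ = ρ} {u = u} {i} e rewrite e with i ℕ.≡ᵇ ρ u
... | true = refl
... | false = refl

𝒩-just : ∀ {N u U} → N u ≡ just U → 𝒩 N ρ (idx u (ρ u)) ≡ just (𝒢ᵁ U)
𝒩-just {ρ = ρ} {u = u} e rewrite e | dec-true (ρ u ℕ.≟ ρ u) refl = refl

-- Indices need to agree only on channels. Communications and session binders change the indexing at
-- session names alone, so a derivation under the new indexing can be weakened back to the old one.
𝒩-⊑ : ∀ {N N′} → N ⊑ N′ → (∀ u U → N u ≡ just U → ρ u ≡ ρ′ u) → 𝒩 N ρ ⊑ 𝒩 N′ ρ′
𝒩-⊑ {ρ = ρ} {ρ′} {N} {N′} ⊑ eq (idx u i) U e with N u in Nu
... | just V rewrite ⊑ u V Nu | eq u V Nu = e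
... | nothing with i ℕ.≡ᵇ ρ u
...   | true = contradiction e λ ()
...   | false = contradiction e λ ()

𝒩-⊕ : ∀ {N N₁ u U} → N₁ ≐ N ⊕ u ∶ U → 𝒩 N₁ (ρ [ u ↦ 1 ]) ≐ 𝒩 N ρ ⊕ idx u 1 ∶ 𝒢ᵁ U
𝒩-⊕ {ρ = ρ} {N} {u = u} e .fresh = 𝒩-nothing {ρ = ρ} {N = N} {u} {1} (e .fresh)
𝒩-⊕ {ρ = ρ} {N₁ = N₁} {u} {U} e .at =
  subst (λ i → 𝒩 N₁ (ρ [ u ↦ 1 ]) (idx u i) ≡ just (𝒢ᵁ U)) (Upᴵ.update-same ρ u)
    (𝒩-just {ρ = ρ [ u ↦ 1 ]} {N = N₁} (e .at))
𝒩-⊕ e .away (prp _ _) _ = refl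
𝒩-⊕ {ρ = ρ} {N} {u = u} e .away (idx v i) w≢ with v ≟ u
... | no v≢u rewrite e .away v v≢u = refl
... | yes refl rewrite dec-false (i ℕ.≟ 1) (λ { refl → w≢ refl }) =
  sym (𝒩-nothing {ρ = ρ} {N = N} {v} {i} (e .fresh))

-- Disjoint domains

Disjoint : Env K A → Env K B → Set
Disjoint f g = ∀ k → f k ≡ nothing ⊎ g k ≡ nothing

module _ {f : Env K A} {Δ Δ₁ Δ₂ : Env K B} where

  disjoint-⊞ : Disjoint f Δ₁ → Disjoint f Δ₂ → Δ ≐ Δ₁ ⊞ Δ₂ → Disjoint f Δ
  disjoint-⊞ d₁ d₂ s k with Δ k | Δ₁ k | Δ₂ k | s k | d₁ k | d₂ k
  ... | _ | _ | _ | left | d | _ = d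
  ... | _ | _ | _ | right | _ | d = d

  disjoint-⊞ˡ : Disjoint f Δ → Δ ≐ Δ₁ ⊞ Δ₂ → Disjoint f Δ₁
  disjoint-⊞ˡ d s k with Δ k | Δ₁ k | Δ₂ k | s k | d k
  ... | _ | _ | _ | left | e = e
  ... | _ | _ | _ | right | _ = inj₂ refl

disjoint-absent : {f : Env K A} {Δ : Env K B} {u : K} {b : B} →
  Disjoint f Δ → Δ u ≡ just b → f u ≡ nothing
disjoint-absent {u = u} d e with d u
... | inj₁ n = n
... | inj₂ n = contradiction (trans (sym e) n) λ ()

disjoint-sym : {f : Env K A} {Δ : Env K B} → Disjoint f Δ → Disjoint Δ f
disjoint-sym d k with d k
... | inj₁ e = inj₂ e
... | inj₂ e = inj₁ e

module _ (_≟ᴷ_ : DecidableEquality K) {f : Env K A} {Δ Δ₀ : Env K B} {u : K} {b : B} where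

  disjoint-⊕ : Disjoint f Δ₀ → f u ≡ nothing → Δ ≐ Δ₀ ⊕ u ∶ b → Disjoint f Δ
  disjoint-⊕ d n e v with v ≟ᴷ u
  ... | yes refl = inj₁ n
  ... | no v≢u rewrite e .away v v≢u = d v

  disjoint-⊖ : Disjoint f Δ → Δ ≐ Δ₀ ⊕ u ∶ b → Disjoint f Δ₀
  disjoint-⊖ d e v with v ≟ᴷ u
  ... | yes refl = inj₂ (e .fresh)
  ... | no v≢u rewrite sym (e .away v v≢u) = d v

disjoint-∖ : (_≟ᴷ_ : DecidableEquality K) {f f₁ : Env K A} {Δ : Env K B} {u : K} →
  Disjoint f₁ Δ → f ≐ f₁ ∖ u → Disjoint f Δ
disjoint-∖ _≟ᴷ_ {u = u} d e v with v ≟ᴷ u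
... | yes refl = inj₁ (e .gone)
... | no v≢u rewrite e .kept v v≢u = d v

disjoint-move : (_≟ᴷ_ : DecidableEquality K) {X X₀ : Env K A} {Λ Λ₀ : Env K B} {x : K} {a : A} {b : B} →
  Disjoint X₀ Λ₀ → X ≐ X₀ ⊕ x ∶ a → Λ₀ ≐ Λ ⊕ x ∶ b → Disjoint X Λ
disjoint-move _≟ᴷ_ {x = x} d e f v with v ≟ᴷ x
... | yes refl = inj₂ (f .fresh)
... | no v≢x rewrite e .away v v≢x | sym (f .away v v≢x) = d v

⊢ⁿ-disjoint : ∀ {Γ Δ u C} → Γ ∣ Δ ⊢ⁿ u ▷ C → Disjoint (chans Γ) Δ
⊢ⁿ-disjoint (Sess e n) = disjoint-⊕ _≟_ (λ _ → inj₂ refl) n e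
⊢ⁿ-disjoint (Sh _ e) u = inj₂ (e u)

mutual
  -- Only Weak states disjointness; the other rules preserve it through their freshness conditions.
  -- It is needed to apply Weak on the minimal side, and to know that a session name is no channel.
  ⊢ᵛ-disjoint : ∀ {Γ Λ Δ V U} → Γ ∣ Λ ∣ Δ ⊢ᵛ V ▷ U → Γ # Λ ∣ Δ
  ⊢ᵛ-disjoint (LVar e z n) = disjoint-⊕ ℕ._≟_ (λ _ → inj₂ refl) n e , λ u → inj₂ (z u)
  ⊢ᵛ-disjoint (Prom-var _ _ d) = ⊢ᵛ-disjoint d
  ⊢ᵛ-disjoint (Prom-lam _ _ d) = ⊢ᵛ-disjoint d
  ⊢ᵛ-disjoint (EProm e f d) = disjoint-move ℕ._≟_ (proj₁ (⊢ᵛ-disjoint d)) e f , proj₂ (⊢ᵛ-disjoint d)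
  ⊢ᵛ-disjoint (Abs d _ e s) =
    proj₁ (⊢-disjoint d) , disjoint-∖ _≟_ (disjoint-⊞ˡ (proj₂ (⊢-disjoint d)) s) e
  ⊢ᵛ-disjoint (Weak _ d _) = d

  ⊢-disjoint : ∀ {Γ Λ Δ P} → Γ ∣ Λ ∣ Δ ⊢ P → Γ # Λ ∣ Δ
  ⊢-disjoint (Nil e f) = (λ x → inj₂ (e x)) , λ u → inj₂ (f u)
  ⊢-disjoint (EProm e f d) = disjoint-move ℕ._≟_ (proj₁ (⊢-disjoint d)) e f , proj₂ (⊢-disjoint d)
  ⊢-disjoint (App v n s) =
    proj₁ (⊢ᵛ-disjoint v) , disjoint-⊞ (proj₂ (⊢ᵛ-disjoint v)) (⊢ⁿ-disjoint n) s
  ⊢-disjoint (Send s e d v l f) =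
    disjoint-⊞ (proj₁ (⊢-disjoint d)) (proj₁ (⊢ᵛ-disjoint v)) l ,
    disjoint-⊕ _≟_ (disjoint-⊖ _≟_ dis e) (disjoint-absent dis (e .at)) f
    where
    dis = disjoint-⊞ (proj₂ (⊢-disjoint d)) (proj₂ (⊢ᵛ-disjoint v)) s
  ⊢-disjoint (Rcv e d _ _ x l f) =
    disjoint-∖ ℕ._≟_ (disjoint-⊞ˡ (proj₁ (⊢-disjoint d)) l) x ,
    disjoint-⊕ _≟_ (disjoint-⊖ _≟_ dis e) (disjoint-absent dis (e .at)) f
    where
    dis = proj₂ (⊢-disjoint d)
  ⊢-disjoint (Req _ _ d _ v s) =
    proj₁ (⊢-disjoint d) , disjoint-⊞ (proj₂ (⊢-disjoint d)) (proj₂ (⊢ᵛ-disjoint v)) s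
  ⊢-disjoint (Acc _ _ d _ _ x l) =
    disjoint-∖ ℕ._≟_ (disjoint-⊞ˡ (proj₁ (⊢-disjoint d)) l) x , proj₂ (⊢-disjoint d)
  ⊢-disjoint (Par d d′ l s) =
    disjoint-⊞ (proj₁ (⊢-disjoint d)) (proj₁ (⊢-disjoint d′)) l ,
    disjoint-⊞ (proj₂ (⊢-disjoint d)) (proj₂ (⊢-disjoint d′)) s
  ⊢-disjoint (End d n e) = proj₁ (⊢-disjoint d) , disjoint-⊕ _≟_ (proj₂ (⊢-disjoint d)) n e
  ⊢-disjoint (Res e d) =
    proj₁ (⊢-disjoint d) , disjoint-sym (disjoint-⊖ _≟_ (disjoint-sym (proj₂ (⊢-disjoint d))) e)
  ⊢-disjoint (ResS e f d) =
    proj₁ (⊢-disjoint d) , disjoint-⊖ _≟_ (disjoint-⊖ _≟_ (proj₂ (⊢-disjoint d)) f) e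
  ⊢-disjoint (Weak _ d _) = d

-- Tracking the source environments

-- EProm, Prom and Weak can be stacked in many ways, but the final environments still tell where `x`
-- comes from, whatever its multiplicity.
⊢var-inv : ∀ {Γ Λ Δ x m C} → Γ ∣ Λ ∣ Δ ⊢ᵛ var x ▷ fun m C →
  (vars Γ x ≡ just C × Λ ≐∅ ⊎ vars Γ x ≡ nothing × Λ ≐ ∅ ⊕ x ∶ C) × Δ ≐∅
⊢var-inv (LVar e z n) = inj₂ (n , e) , z
⊢var-inv (Prom-var _ _ d) = ⊢var-inv d
⊢var-inv {x = x} (EProm {x = y} e f d) with ⊢var-inv d
... | inj₁ (_ , z) , z′ = contradiction (trans (sym (f .at)) (z y)) λ ()
... | inj₂ (n , g) , z′ with y ℕ.≟ x
...   | no y≢x = contradiction (trans (sym (f .at)) (g .away y y≢x)) λ ()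
...   | yes refl with trans (sym (f .at)) (g .at)
...     | refl = inj₁ (e .at , empty) , z′
  where
  empty : _ ≐∅
  empty v with v ℕ.≟ x
  ... | yes refl = f .fresh
  ... | no v≢x = trans (sym (f .away v v≢x)) (g .away v v≢x)
⊢var-inv {x = x} (Weak (⊑ , _) (dis , _) d) with ⊢var-inv d
... | inj₁ (e , z) , z′ = inj₁ (⊑ x _ e , z) , z′
... | inj₂ (n , g) , z′ = inj₂ (disjoint-absent dis (g .at) , g) , z′

-- One map `τ` describes shared and linear variables alike, so EProm, which moves a variable between
-- the two, leaves it unchanged.
record Covers (X Λ : Env Var CTy) (τ : Typing) : Set where
  field
    unr-var : ∀ {x C} → X x ≡ just C → τ x ≡ C
    lin-var : ∀ {x C} → Λ x ≡ just C → τ x ≡ C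

open Covers

module Upᵛ = Update ℕ._≟_

private
  variable
    τ : Typing

covers-⊞ : ∀ {X Λ Λ₁ Λ₂} → Λ ≐ Λ₁ ⊞ Λ₂ → Covers X Λ τ → Covers X Λ₁ τ
covers-⊞ s c .unr-var = c .unr-var
covers-⊞ s c .lin-var e = c .lin-var (⊞-lookupˡ s e)

covers-⊑ : ∀ {X X₀ Λ} → X₀ ⊑ X → Covers X Λ τ → Covers X₀ Λ τ
covers-⊑ ⊑ c .unr-var e = c .unr-var (⊑ _ _ e)
covers-⊑ ⊑ c .lin-var = c .lin-var

covers-move : ∀ {X X₀ Λ Λ₀ x C} → X ≐ X₀ ⊕ x ∶ C → Λ₀ ≐ Λ ⊕ x ∶ C →
  Covers X Λ τ → Covers X₀ Λ₀ τ
covers-move {x = x} e f c .unr-var {y} eq with y ℕ.≟ x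
... | yes refl = contradiction (trans (sym eq) (e .fresh)) λ ()
... | no y≢x = c .unr-var (trans (e .away y y≢x) eq)
covers-move {x = x} e f c .lin-var {y} eq with y ℕ.≟ x
... | no y≢x = c .lin-var (trans (sym (f .away y y≢x)) eq)
... | yes refl with trans (sym (f .at)) eq
...   | refl = c .unr-var (e .at)

covers-bind : ∀ {X X₁ N Λ Λ₁ Λ₂ Δ x m C} →
  ⟨ X₁ ⨾ N ⟩ ∣ Λ₂ ∣ Δ ⊢ᵛ var x ▷ fun m C → Disjoint X₁ Λ₁ →
  X ≐ X₁ ∖ x → Λ₁ ≐ Λ ⊞ Λ₂ →
  Covers X Λ τ → Covers X₁ Λ₁ (Upᵛ.update τ x C)
covers-bind {τ = τ} {x = x} {C = C} d dis e s c .unr-var {y} {D} eq with y ℕ.≟ x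
... | no y≢x = trans (Upᵛ.update-other τ y≢x) (c .unr-var (trans (e .kept y y≢x) eq))
... | yes refl with proj₁ (⊢var-inv d)
...   | inj₂ (n , _) = contradiction (trans (sym eq) n) λ ()
...   | inj₁ (eq′ , _) with trans (sym eq) eq′
...     | refl = Upᵛ.update-same τ x
covers-bind {τ = τ} {Λ = Λ} {Λ₁} {Λ₂} {x = x} d dis e s c .lin-var {y} {D} eq
  with y ℕ.≟ x | proj₁ (⊢var-inv d)
... | yes refl | inj₁ (eq′ , _) =
  contradiction (trans (sym eq′) (disjoint-absent dis eq)) λ ()
... | yes refl | inj₂ (_ , f) with trans (sym eq) (⊞-lookupˡ (⊞-comm s) (f .at))
...   | refl = Upᵛ.update-same τ x
covers-bind {τ = τ} {Λ = Λ} {Λ₁} {Λ₂} {x = x} d dis e s c .lin-var {y} {D} eq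
  | no y≢x | inv = trans (Upᵛ.update-other τ y≢x) (c .lin-var (below (Λ₂y inv)))
  where
  Λ₂y : _ × Λ₂ ≐∅ ⊎ _ × Λ₂ ≐ ∅ ⊕ x ∶ _ → Λ₂ y ≡ nothing
  Λ₂y (inj₁ (_ , z)) = z y
  Λ₂y (inj₂ (_ , f)) = f .away y y≢x
  below : Λ₂ y ≡ nothing → Λ y ≡ just D
  below n with Λ₁ y | Λ y | Λ₂ y | s y
  below n | _ | _ | _ | left = eq
  below n | _ | _ | _ | right = contradiction (trans (sym eq) n) λ ()

-- Shape Used m Ms: Ms is the row of a name of type m, and Used says whether
-- the name still occurs.
data Shape (Used : Set) : Maybe STy → List STyᵐ → Set where
  absent  : Shape Used nothing []
  present : ∀ {S} → Shape Used (just S) (𝒢ˢ S)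
  done    : ¬ Used → Shape Used (just end) []

shape-⊆ : {P Q : Set} → (Q → P) → ∀ {m Ms} → Shape P m Ms → Shape Q m Ms
shape-⊆ f absent = absent
shape-⊆ f present = present
shape-⊆ f (done ¬p) = done λ q → ¬p (f q)

shape-nothing : ∀ {P m Ms} → Shape P m Ms → m ≡ nothing → Ms ≡ []
shape-nothing absent _ = refl

shape-used : ∀ {P m Ms S} → Shape P m Ms → P → m ≡ just S → Ms ≡ 𝒢ˢ S
shape-used present p refl = refl
shape-used (done ¬p) p _ = contradiction p ¬p

shape-end : ∀ {P m Ms} → Shape P m Ms → m ≡ just end → Ms ≡ end ∷ [] ⊎ Ms ≡ []
shape-end present refl = inj₁ refl
shape-end (done _) _ = inj₂ refl

-- The implications go only from the environments to `E`: the breakdown passes the same `E` to both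
-- sides of a split, so `E` also knows names that the other side owns.
record Tracks (N : Env Ident UTy) (Δ : SessEnv) (us : List Ident) (E : TypeInfo) (L : Rows) : Set where
  field
    sess-info : ∀ {u S} → Δ u ≡ just S → E u ≡ just (sess S)
    chan-info : ∀ {u U} → N u ≡ just U → E u ≡ just (chan U)
    shape     : ∀ u → Shape (u ∈ us) (Δ u) (L u)

open Tracks

private
  variable
    E : TypeInfo
    us vs : List Ident

_↾_ : Rows → SessEnv → Rows
(L ↾ Δ) u = Maybe.maybe′ (λ _ → L u) [] (Δ u)

tracks-⊞ : ∀ {N Δ Δ₁ Δ₂} → Δ ≐ Δ₁ ⊞ Δ₂ → vs ⊆ us → Tracks N Δ us E L → Tracks N Δ₁ vs E (L ↾ Δ₁)
tracks-⊞ s _ t .sess-info e = t .sess-info (⊞-lookupˡ s e)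
tracks-⊞ s _ t .chan-info = t .chan-info
tracks-⊞ {Δ = Δ} {Δ₁} {Δ₂} s i t .shape u with Δ u | Δ₁ u | Δ₂ u | s u | t .shape u
... | nothing | _ | _ | left | _ = absent
... | just _ | _ | _ | left | sh = shape-⊆ i sh
... | _ | _ | _ | right | _ = absent

-- Restricting to the two parts loses the rows of names outside `Δ`; by `shape` these are empty.
⟦⟧-⊞ : ∀ {N Δ Δ₁ Δ₂} → Δ ≐ Δ₁ ⊞ Δ₂ → Tracks N Δ us E L →
  ⟦ L ⟧ ρ ≐ ⟦ L ↾ Δ₁ ⟧ ρ ⊞ ⟦ L ↾ Δ₂ ⟧ ρ
⟦⟧-⊞ {L = L} {Δ = Δ} {Δ₁} {Δ₂} s t (idx u i) with Δ u | Δ₁ u | Δ₂ u | s u | t .shape u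
... | nothing | _ | _ | left | sh rewrite shape-nothing sh refl = left
... | just _ | _ | _ | left | _ = left
... | nothing | _ | _ | right | sh rewrite shape-nothing sh refl = left
... | just _ | _ | _ | right | _ = right
⟦⟧-⊞ s t (prp _ _) = left

tracks-⊆ : ∀ {N Δ us vs} → vs ⊆ us → Tracks N Δ us E L → Tracks N Δ vs E L
tracks-⊆ i t .sess-info = t .sess-info
tracks-⊆ i t .chan-info = t .chan-info
tracks-⊆ i t .shape u = shape-⊆ i (t .shape u)

tracks-⊑ : ∀ {N N₀ Δ} → N₀ ⊑ N → Tracks N Δ us E L → Tracks N₀ Δ us E L
tracks-⊑ ⊑ t .sess-info = t .sess-info
tracks-⊑ ⊑ t .chan-info e = t .chan-info (⊑ _ _ e)
tracks-⊑ ⊑ t .shape = t .shape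

apart : ∀ {N Δ} → Disjoint N Δ → Tracks N Δ us E L → ∀ u → N u ≡ nothing ⊎ L u ≡ []
apart d t u with d u
... | inj₁ e = inj₁ e
... | inj₂ e = inj₂ (shape-nothing (t .shape u) e)

-- Disjointness already holds for the names without indices, hence for two unrelated indexings. They
-- do differ when a continuation typed under its own indexing is weakened.
𝒩-disjoint : ∀ {N Δ p n} → Disjoint N Δ → Tracks N Δ us E L →
  Disjoint (𝒩 N ρ) (join (⟦ L ⟧ ρ′) p n)
𝒩-disjoint {ρ = ρ} {N = N} d t (idx u i) with apart d t u
... | inj₁ e = inj₁ (𝒩-nothing {ρ = ρ} {N = N} {u} {i} e)
... | inj₂ e rewrite e = inj₂ refl
𝒩-disjoint d t (prp _ _) = inj₁ refl

-- Comm T M S: a communication on a name of type T has the minimal type M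
-- and leaves S.
data Comm : STy → STyᵐ → STy → Set where
  !⨾ : ∀ {U S} → Comm (! U ⨾ S) !⟨ 𝒢ᵁ U ∷ [] ⟩⨾end S
  ¿⨾ : ∀ {U S} → Comm (¿ U ⨾ S) ¿⟨ 𝒢ᵁ U ∷ [] ⟩⨾end S

𝒢ˢ-comm : ∀ {T M S} → Comm T M S → 𝒢ˢ T ≡ M ∷ 𝒢ᵗ S
𝒢ˢ-comm !⨾ = refl
𝒢ˢ-comm ¿⨾ = refl

advance-sess : ∀ {T M S u} → Comm T M S → E u ≡ just (sess T) →
  advance E u ≡ E [ u ↦ just (sess S) ]
advance-sess !⨾ e rewrite e = refl
advance-sess ¿⨾ e rewrite e = refl

advance-chan : ∀ {u U} → E u ≡ just (chan U) → advance E u ≡ E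
advance-chan e rewrite e = refl

next-sess : ∀ {S u} → E u ≡ just (sess S) → next E u ρ ≡ ρ [ u ↦ suc (ρ u) ]
next-sess e rewrite e = refl

next-chan : ∀ {u U} → E u ≡ just (chan U) → next E u ρ ≡ ρ
next-chan e rewrite e = refl

module _ {N : Env Ident UTy} {Δ Δ₀ Δ₁ : SessEnv} {u : Ident} {T S : STy} {M : STyᵐ}
  (c : Comm T M S) (e : Δ ≐ Δ₀ ⊕ u ∶ T) (f : Δ₁ ≐ Δ₀ ⊕ u ∶ S) where

  tracks-comm : Disjoint N Δ → (DoneAfter E u → u ∉ us) → Tracks N Δ (u ∷ us) E L →
    Tracks N Δ₁ us (advance E u) (L [ u ↦ 𝒢ᵗ S ])
  tracks-comm {E = E} {us = us} {L = L} dis nouse t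
    = subst (λ E′ → Tracks N Δ₁ us E′ (L [ u ↦ 𝒢ᵗ S ])) (sym advanced)
        (record { sess-info = info-s ; chan-info = info-c ; shape = sh })
    where
    advanced = advance-sess c (t .sess-info (e .at))
    -- `DoneAfter` speaks of `E`, whereas the new row is computed from `S`; `advanced` links them.
    nouse′ : S ≡ end → u ∉ us
    nouse′ refl = nouse (trans (cong (λ E′ → E′ u) advanced) (Upᴵ.update-same E u))
    info-s : ∀ {v R} → Δ₁ v ≡ just R → (E [ u ↦ just (sess S) ]) v ≡ just (sess R)
    info-s {v} eq with v ≟ u
    ... | no v≢u = t .sess-info (trans (e .away v v≢u) (trans (sym (f .away v v≢u)) eq))
    ... | yes refl with trans (sym (f .at)) eq
    ...   | refl = refl
    info-c : ∀ {v U} → N v ≡ just U → (E [ u ↦ just (sess S) ]) v ≡ just (chan U)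
    info-c {v} eq with v ≟ u
    ... | no v≢u = t .chan-info eq
    ... | yes refl = contradiction (trans (sym eq) (disjoint-absent dis (e .at))) λ ()
    continuation : ∀ R → (R ≡ end → u ∉ us) → Shape (u ∈ us) (just R) (𝒢ᵗ R)
    continuation end nu = done (nu refl)
    continuation (! _ ⨾ _) _ = present
    continuation (¿ _ ⨾ _) _ = present
    sh : ∀ v → Shape (v ∈ us) (Δ₁ v) ((L [ u ↦ 𝒢ᵗ S ]) v)
    sh v with v ≟ u
    ... | yes refl rewrite f .at = continuation S nouse′
    ... | no v≢u rewrite f .away v v≢u | sym (e .away v v≢u) = shape-⊆ there (t .shape v)

  ⟦⟧-comm : Tracks N Δ (u ∷ us) E L →
    ⟦ L ⟧ ρ ≐ ⟦ L [ u ↦ 𝒢ᵗ S ] ⟧ (next E u ρ) ⊕ idx u (ρ u) ∶ M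
  ⟦⟧-comm {E = E} {L = L} {ρ = ρ} t =
    subst (λ σ → ⟦ L ⟧ ρ ≐ ⟦ L [ u ↦ 𝒢ᵗ S ] ⟧ σ ⊕ idx u (ρ u) ∶ M)
      (sym (next-sess {E = E} {ρ = ρ} (t .sess-info (e .at))))
      (⟦⟧-⊕ (trans (shape-used (t .shape u) (here refl) (e .at)) (𝒢ˢ-comm c)) (Upᴵ.update-same L u)
        (inj₁ (Upᴵ.update-same ρ u)) λ v v≢u → Upᴵ.update-other L v≢u , Upᴵ.update-other ρ v≢u)

tracks-end : ∀ {N Δ Δ₀ u} → Δ ≐ Δ₀ ⊕ u ∶ end → Tracks N Δ us E L → Tracks N Δ₀ us E (L [ u ↦ [] ])
tracks-end {u = u} e t .sess-info {v} eq with v ≟ u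
... | yes refl = contradiction (trans (sym eq) (e .fresh)) λ ()
... | no v≢u = t .sess-info (trans (e .away v v≢u) eq)
tracks-end e t .chan-info = t .chan-info
tracks-end {u = u} e t .shape v with v ≟ u
... | yes refl rewrite e .fresh = absent
... | no v≢u rewrite sym (e .away v v≢u) = t .shape v

tracks-bind-sess : ∀ {N Δ Δ₁ u S} → Δ₁ ≐ Δ ⊕ u ∶ S → N u ≡ nothing →
  (∀ {v} → v ≢ u → v ∈ us → v ∈ vs) →
  Tracks N Δ vs E L → Tracks N Δ₁ us (E [ u ↦ just (sess S) ]) (L [ u ↦ 𝒢ˢ S ])
tracks-bind-sess {u = u} e n i t .sess-info {v} eq with v ≟ u
... | no v≢u = t .sess-info (trans (sym (e .away v v≢u)) eq)
... | yes refl with trans (sym (e .at)) eq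
...   | refl = refl
tracks-bind-sess {u = u} e n i t .chan-info {v} eq with v ≟ u
... | yes refl = contradiction (trans (sym eq) n) λ ()
... | no v≢u = t .chan-info eq
tracks-bind-sess {u = u} e n i t .shape v with v ≟ u
... | yes refl rewrite e .at = present
... | no v≢u rewrite e .away v v≢u = shape-⊆ (i v≢u) (t .shape v)

tracks-bind-chan : ∀ {N N₁ Δ Δ₁ u U} → Δ₁ ≗ Δ → N₁ u ≡ just U → Δ u ≡ nothing →
  (∀ v → v ≢ u → N₁ v ≡ N v) → (∀ {v} → v ≢ u → v ∈ us → v ∈ vs) →
  Tracks N Δ vs E L → Tracks N₁ Δ₁ us (E [ u ↦ just (chan U) ]) (L [ u ↦ [] ])
tracks-bind-chan {u = u} eq e n f i t .sess-info {v} eq′ with v ≟ u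
... | yes refl = contradiction (trans (sym eq′) (trans (eq v) n)) λ ()
... | no v≢u = t .sess-info (trans (sym (eq v)) eq′)
tracks-bind-chan {u = u} eq e n f i t .chan-info {v} eq′ with v ≟ u
... | no v≢u = t .chan-info (trans (sym (f v v≢u)) eq′)
... | yes refl with trans (sym e) eq′
...   | refl = refl
tracks-bind-chan {u = u} eq e n f i t .shape v with v ≟ u
... | yes refl rewrite eq v | n = absent
... | no v≢u rewrite eq v = shape-⊆ (i v≢u) (t .shape v)

-- Abs does not state that its name is fresh for the outer session environment. For a session name
-- the split forces it, for a channel disjointness does.
binder-fresh : ∀ {Γ Δ Δ₁ Δ₂ u C} → Γ ∣ Δ₂ ⊢ⁿ u ▷ C → Disjoint (chans Γ) Δ₁ → Δ₁ ≐ Δ ⊞ Δ₂ → Δ u ≡ nothing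
binder-fresh (Sess e _) _ s = ⊞-⊕ s e .fresh
binder-fresh (Sh e _) d s = ⊞-nothing s (disjoint-absent (disjoint-sym d) e)

tracks-bind : ∀ {Γ N Δ Δ₁ Δ₂ u C} → Γ ∣ Δ₂ ⊢ⁿ u ▷ C → Disjoint (chans Γ) Δ₁ → N ≐ chans Γ ∖ u → Δ₁ ≐ Δ ⊞ Δ₂ →
  (∀ {v} → v ≢ u → v ∈ us → v ∈ vs) →
  Tracks N Δ vs E L → Tracks (chans Γ) Δ₁ us (E [ u ↦ just C ]) (L [ u ↦ rowOf C ])
tracks-bind {Γ = Γ} {N} {u = u} (Sess e n) d f s i t = tracks-bind-sess (⊞-⊕ s e) n i (tracks-⊑ same t)
  where
  same : chans Γ ⊑ N
  same v U eq with v ≟ u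
  ... | yes refl = contradiction (trans (sym eq) n) λ ()
  ... | no v≢u = trans (f .kept v v≢u) eq
tracks-bind {Δ = Δ} {Δ₁} {Δ₂} n@(Sh e z) d f s i t =
  tracks-bind-chan same e (binder-fresh n d s) (λ v v≢u → sym (f .kept v v≢u)) i t
  where
  same : Δ₁ ≗ Δ
  same v with Δ₁ v | Δ v | Δ₂ v | s v | z v
  ... | _ | _ | _ | left | _ = refl
  ... | _ | _ | _ | right | eq = eq

𝒩-∖∖ : ∀ {Γ N Δ u C} → Γ ∣ Δ ⊢ⁿ u ▷ C → N ≐ chans Γ ∖ u →
  𝒩 N ρ ≐ 𝒩 (chans Γ) (ρ [ u ↦ 1 ]) ∖∖ map (idx u) (interval 1 (length (𝒢ᶜ C)))
𝒩-∖∖ {ρ = ρ} {Γ} {N} {Δ} {u} {C} n f = record { gone = gone∈ ; kept = kept∉ }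
  where
  gone∈ : ∀ w → w ∈ map (idx u) (interval 1 (length (𝒢ᶜ C))) → 𝒩 N ρ w ≡ nothing
  gone∈ w m with ∈-map⁻ (idx u) m
  ... | i , _ , refl = 𝒩-nothing {ρ = ρ} {N = N} {u} {i} (f .gone)
  -- Outside the indices of the binder the inner map must be empty as well: a session name is no
  -- channel, and a channel occupies index 1 only.
  bound : ∀ {C} i → Γ ∣ Δ ⊢ⁿ u ▷ C → idx u i ∉ map (idx u) (interval 1 (length (𝒢ᶜ C))) →
    nothing ≡ (if i ℕ.≡ᵇ 1 then Maybe.map 𝒢ᵁ (chans Γ u) else nothing)
  bound i (Sess _ e) _ rewrite e with i ℕ.≡ᵇ 1
  ... | true = refl
  ... | false = refl
  bound i (Sh _ _) m rewrite dec-false (i ℕ.≟ 1) λ { refl → m (here refl) } = refl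
  kept∉ : ∀ w → w ∉ map (idx u) (interval 1 (length (𝒢ᶜ C))) →
    𝒩 N ρ w ≡ 𝒩 (chans Γ) (ρ [ u ↦ 1 ]) w
  kept∉ (prp _ _) _ = refl
  kept∉ (idx v i) m with v ≟ u
  ... | no v≢u rewrite f .kept v v≢u = refl
  ... | yes refl = trans (𝒩-nothing {ρ = ρ} {N = N} {u} {i} (f .gone)) (bound i n m)

names-ok : ∀ {Γ Δ Δ′ u C} → Γ ∣ Δ ⊢ⁿ u ▷ C → Δ′ ≗ single u (ρ u) (rowOf C) →
  ⟨ X ⨾ 𝒩 (chans Γ) ρ ⟩ ∣ Δ′ ⊢ᵐⁿ⋆ map (idx u) (interval (ρ u) (length (𝒢ᶜ C))) ▷ 𝒢ᶜ C
names-ok {ρ = ρ} {X = X} {Γ = Γ} {Δ′ = Δ′} {u} (Sess {S = S} _ n) eq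
  = subst (λ n → ⟨ X ⨾ 𝒩 (chans Γ) ρ ⟩ ∣ Δ′ ⊢ᵐⁿ⋆ map (idx u) (interval (ρ u) n) ▷ map sess (𝒢ˢ S))
      (sym (length-map sess (𝒢ˢ S)))
      (row-ok (ρ u) (𝒢ˢ S) (λ j → 𝒩-nothing {ρ = ρ} {N = chans Γ} {u} {j} n) eq)
names-ok {ρ = ρ} {X = X} {Γ = Γ} {Δ′ = Δ′} {u} (Sh {U = U} e _) eq
  = subst (λ is → ⟨ X ⨾ 𝒩 (chans Γ) ρ ⟩ ∣ Δ′ ⊢ᵐⁿ⋆ map (idx u) is ▷ 𝒢ᶜ (chan U))
      (sym (interval-suc (ρ u) 0))
      (cons (Sh (𝒩-just {ρ = ρ} {N = chans Γ} e) empty) ([] empty) (⊞-∅ʳ empty))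
  where
  empty : Δ′ ≐∅
  empty w = trans (eq w) (single-[] w)

name-info : ∀ {Γ Δ u C} → Γ ∣ Δ ⊢ⁿ u ▷ C → Tracks (chans Γ) Δ us E L → E u ≡ just C
name-info (Sess e _) t = t .sess-info (e .at)
name-info (Sh e _) t = t .chan-info e

name-row : ∀ {Γ Δ u C} → Γ ∣ Δ ⊢ⁿ u ▷ C → u ∈ us → Tracks (chans Γ) Δ us E L →
  ⟦ L ⟧ ρ ≗ single u (ρ u) (rowOf C)
name-row {L = L} {ρ = ρ} {Δ = Δ} {u} {C} n m t w =
  trans (⟦⟧-single (λ v v≢u → shape-nothing (t .shape v) (other n v v≢u)) w)
    (cong (λ Ms → single u (ρ u) Ms w) (row n))
  where
  other : ∀ {C} → _ ∣ Δ ⊢ⁿ u ▷ C → ∀ v → v ≢ u → Δ v ≡ nothing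
  other (Sess e _) v v≢u = e .away v v≢u
  other (Sh _ z) v _ = z v
  row : ∀ {C} → _ ∣ Δ ⊢ⁿ u ▷ C → L u ≡ rowOf C
  row (Sess e _) = shape-used (t .shape u) m (e .at)
  row (Sh _ z) = shape-nothing (t .shape u) (z u)

-- Restrictions

𝒢ˢ-dual : ∀ S → map dualᵐ (𝒢ˢ S) ≡ 𝒢ˢ (dual S)
𝒢ᵗ-dual : ∀ S → map dualᵐ (𝒢ᵗ S) ≡ 𝒢ᵗ (dual S)
𝒢ˢ-dual end = refl
𝒢ˢ-dual (! U ⨾ S) = cong (_ ∷_) (𝒢ᵗ-dual S)
𝒢ˢ-dual (¿ U ⨾ S) = cong (_ ∷_) (𝒢ᵗ-dual S)
𝒢ᵗ-dual end = refl
𝒢ᵗ-dual (! U ⨾ S) = cong (_ ∷_) (𝒢ᵗ-dual S)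
𝒢ᵗ-dual (¿ U ⨾ S) = cong (_ ∷_) (𝒢ᵗ-dual S)

private
  variable
    F F⁺ F⁻ G⁺ G⁻ H⁺ H⁻ : SessEnvᵐ

-- F⁺ and F⁻ are the assignments still to be discharged at the two polarities:
-- the pair G⁺, G⁻ is discharged here, H⁺ and H⁻ remain.
ν-ok : ∀ {s ann M} → Δ′ ≐ Δ ⊞ F → F ≐ F⁺ ⊞ F⁻ → F⁺ ≐ G⁺ ⊞ H⁺ → F⁻ ≐ G⁻ ⊞ H⁻ →
  G⁺ ≐ ∅ ⊕ endpoint pos s ∶ M → G⁻ ≐ ∅ ⊕ endpoint neg s ∶ dualᵐ M → MaybeAll.All (_≡ M) ann →
  (∀ {Δ F} → Δ′ ≐ Δ ⊞ F → F ≐ H⁺ ⊞ H⁻ → X ∣ N ∣ Δ ⊢ R ok) →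
  X ∣ N ∣ Δ ⊢ νˢ s ann R ok
ν-ok s t s⁺ s⁻ e⁺ e⁻ a d =
  ResS a
    (⊞-⊕ (λ w → proj₂ (inner w)) e⁺)
    (⊞-⊕ (λ w → proj₁ (inner w)) e⁻)
    (d (λ w → proj₁ (outer w)) (λ w → proj₂ (proj₂ (pairs w))))
  where
  -- `Δ , F` is regrouped as `((Δ , G⁺) , G⁻) , (H⁺ , H⁻)`: two extensions for ResS, and the rest
  -- for the remaining restrictions.
  pairs = λ w → split-interchange (t w) (s⁺ w) (s⁻ w)
  outer = λ w → split-assocˡ (s w) (proj₁ (pairs w))
  inner = λ w → split-assocˡ (proj₂ (outer w)) (proj₁ (proj₂ (pairs w)))

ν-empty : Δ′ ≐ Δ ⊞ F → F ≐ F⁺ ⊞ F⁻ → F⁺ ≐∅ → F⁻ ≐∅ → Δ′ ≗ Δ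
ν-empty {F = F} {F⁺} {F⁻} s t e⁺ e⁻ w = absorb (s w) (vanish (t w) (e⁺ w) (e⁻ w))
  where
  vanish : {l m n : Maybe A} → Split l m n → m ≡ nothing → n ≡ nothing → l ≡ nothing
  vanish left e _ = e
  vanish right _ e = e
  absorb : {l m n : Maybe A} → Split l m n → n ≡ nothing → l ≡ m
  absorb left _ = refl
  absorb right e = e

νˢ⋆-ok : ∀ {s} i Ms → Δ′ ≐ Δ ⊞ F →
  F ≐ single (ses pos s) i Ms ⊞ single (ses neg s) i (map dualᵐ Ms) →
  X ∣ N ∣ Δ′ ⊢ R ok → X ∣ N ∣ Δ ⊢ νˢ⋆ s i Ms R ok
νˢ⋆-ok i [] s t d = ⊢ᵐ-resp (ν-empty s t single-[] single-[]) d
νˢ⋆-ok i (M ∷ Ms) s t d =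
  ν-ok s t single-⊞ single-⊞ single-⊕ single-⊕ (MaybeAll.just refl)
    λ s′ t′ → νˢ⋆-ok (suc i) Ms s′ t′ d

-- Without annotations on these restrictions, any list `Ms` of the right length may be chosen for
-- the inputs, with the duals for the outputs.
νᶜ-ok : ∀ k Ms → Δ′ ≐ Δ ⊞ F →
  F ≐ join ∅ (seg k Ms) ∅ ⊞ join ∅ ∅ (seg k (map dualᵐ Ms)) →
  X ∣ N ∣ Δ′ ⊢ R ok → X ∣ N ∣ Δ ⊢ νᶜ k (length Ms) R ok
νᶜ-ok k [] s t d = ⊢ᵐ-resp (ν-empty {F⁺ = join ∅ ∅ ∅} {join ∅ ∅ ∅} s t none none) d
  where
  none : join ∅ ∅ ∅ ≐∅
  none = join-≐∅ (λ _ → refl) (λ _ → refl) (λ _ → refl)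
νᶜ-ok {Δ = Δ} {X = X} {N = N} {R = R} k (M ∷ Ms) s t d =
  subst (λ js → X ∣ N ∣ Δ ⊢ foldr (λ j → νˢ (prp j) nothing) R js ok)
    (sym (interval-suc k (length Ms)))
    (ν-ok s t
      (join-⊞ (λ _ → left) (seg-++ (M ∷ []) {Ms} refl) (λ _ → left))
      (join-⊞ (λ _ → left) (λ _ → left) (seg-++ (dualᵐ M ∷ []) {map dualᵐ Ms} refl))
      (⊕-respʳ {Δ₀ = join ∅ ∅ ∅} none (join-⊕⁺ seg-[]))
      (⊕-respʳ {Δ₀ = join ∅ ∅ ∅} none (join-⊕⁻ seg-[])) MaybeAll.nothing
      λ s′ t′ → νᶜ-ok (suc k) Ms s′ t′ d)
  where
  none : join ∅ ∅ ∅ ≐∅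
  none = join-≐∅ (λ _ → refl) (λ _ → refl) (λ _ → refl)

-- The breakdown

private
  variable
    xs zs : List Var

raise : Disjoint N′ Δ → Y ⊑ X → N ⊑ N′ → Y ∣ N ∣ Δ ⊢ R ok → X ∣ N′ ∣ Δ ⊢ R ok
raise d x n t = Weak (x , n) ((λ _ → inj₂ refl) , d) t

raiseᵛ : Disjoint N′ Δ → N ⊑ N′ → ⟨ X ⨾ N ⟩ ∣ ∅ ∣ Δ ⊢ᵐᵛ V ▷ U → ⟨ X ⨾ N′ ⟩ ∣ ∅ ∣ Δ ⊢ᵐᵛ V ▷ U
raiseᵛ d n t = Weak ((λ _ _ e → e) , n) ((λ _ → inj₂ refl) , d) t

provides-⊆ : Exact X τ xs → zs ⊆ xs → Provides X τ zs
provides-⊆ ex i = provides λ m → ex .inside .provided (i m)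

trailing : ∀ {k} zs → Provides X τ zs → (∀ {p k} → N (prp p k) ≡ nothing) → p ≐∅ →
  X ∣ N ∣ join ∅ p (seg k (dualᵐ (carry τ zs) ∷ [])) ⊢ cₒᵤₜ k zs nil ok
trailing zs pr n e =
  cₒᵤₜ-ok zs pr (join-⊕⁻ seg-[]) n (Nil (λ _ → refl) (join-≐∅ (λ _ → refl) e (λ _ → refl)))

seg-++-dual : ∀ {i j} Ms {Ms′} → j ≡ length Ms + i →
  seg i (map dualᵐ (Ms ++ Ms′)) ≐ seg i (map dualᵐ Ms) ⊞ seg j (map dualᵐ Ms′)
seg-++-dual {i} {j} Ms {Ms′} e =
  subst (λ Ns → seg i Ns ≐ seg i (map dualᵐ Ms) ⊞ seg j (map dualᵐ Ms′))
    (sym (map-++ dualᵐ Ms Ms′))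
    (seg-++ (map dualᵐ Ms) (trans e (cong (_+ i) (sym (length-map dualᵐ Ms)))))

payload-⊞ : ∀ {k j} Ms {M} → j ≡ length Ms + k →
  join D (seg k Ms) (seg k (map dualᵐ (Ms ++ M ∷ []))) ≐
    join ∅ ∅ (seg j (dualᵐ M ∷ [])) ⊞ join D (seg k Ms) (seg k (map dualᵐ Ms))
payload-⊞ Ms {M} e = join-⊞ (λ _ → right) (λ _ → right) (⊞-comm (seg-++-dual Ms {M ∷ []} e))

-- `Ms` types the propagators inside the value being sent, which have both endpoints in `B`; for an
-- input it is empty. `M` types the propagator that triggers `Q`: its output is in `B`, its input in
-- `Q`.
prefix-ok : ∀ {k k′ j B Q} xs Ms {M Ms′} → (∀ {p k} → N (prp p k) ≡ nothing) →
  k′ ≡ suc k → j ≡ length Ms + k′ → D ≐ D₁ ⊞ D₂ →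
  (∀ X → Exact X τ xs → X ∣ N ∣ join D₁ (seg k′ Ms) (seg k′ (map dualᵐ (Ms ++ M ∷ []))) ⊢ B ok) →
  ∅ ∣ N ∣ join D₂ (seg j (M ∷ Ms′)) (seg (suc j) (map dualᵐ Ms′)) ⊢ Q ok →
  ∅ ∣ N ∣ join D (seg k (carry τ xs ∷ Ms ++ M ∷ Ms′)) (seg (suc k) (map dualᵐ (Ms ++ M ∷ Ms′)))
    ⊢ cᵢₙ k xs B ∥ Q ok
prefix-ok {D = D} {τ = τ} {k = k} xs Ms {M} {Ms′} n refl refl s b q =
  Par (cᵢₙ-ok xs (join-⊕⁺ (seg-∷ {xs = Ms})) n b) q (λ _ → left)
    (join-⊞ s
      (seg-++ (carry τ xs ∷ Ms) {M ∷ Ms′} (ℕ.+-suc (length Ms) k))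
      (subst (λ Ns → seg (suc k) (map dualᵐ Ns) ≐ seg (suc k) (map dualᵐ (Ms ++ M ∷ [])) ⊞
          seg (suc (length Ms + suc k)) (map dualᵐ Ms′))
        (++-assoc Ms (M ∷ []) Ms′)
        (seg-++-dual (Ms ++ M ∷ []) (sym (cong (_+ suc k) (trans (length-++ Ms) (ℕ.+-comm (length Ms) 1)))))))

trigger-ok : ∀ {k Q} xs Ms → (∀ {p k} → N (prp p k) ≡ nothing) → Provides X τ xs →
  Disjoint N (join D (seg k (carry τ xs ∷ Ms)) (seg (suc k) (map dualᵐ Ms))) →
  ∅ ∣ N ∣ join D (seg k (carry τ xs ∷ Ms)) (seg (suc k) (map dualᵐ Ms)) ⊢ Q ok →
  X ∣ N ∣ join D (seg k (carry τ xs ∷ Ms)) (seg k (map dualᵐ (carry τ xs ∷ Ms)))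
    ⊢ cₒᵤₜ k xs nil ∥ Q ok
trigger-ok {τ = τ} xs Ms n pr dis q =
  Par (trailing xs pr n (λ _ → refl)) (raise dis (λ _ _ ()) (λ _ _ e → e) q) (λ _ → left)
    (join-⊞ (λ _ → right) (λ _ → right) (seg-++ (dualᵐ (carry τ xs) ∷ []) {map dualᵐ Ms} refl))

split-ok : ∀ {k k′ j Q₁ Q₂} xs ys zs Ms {Ms′} → (∀ {p k} → N (prp p k) ≡ nothing) →
  k′ ≡ suc k → j ≡ length Ms + suc k′ → D ≐ D₁ ⊞ D₂ → ys ⊆ xs → zs ⊆ xs →
  ∅ ∣ N ∣ join D₁ (seg k′ (carry τ ys ∷ Ms)) (seg (suc k′) (map dualᵐ Ms)) ⊢ Q₁ ok →
  ∅ ∣ N ∣ join D₂ (seg j (carry τ zs ∷ Ms′)) (seg (suc j) (map dualᵐ Ms′)) ⊢ Q₂ ok →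
  ∅ ∣ N ∣ join D (seg k (carry τ xs ∷ carry τ ys ∷ Ms ++ carry τ zs ∷ Ms′))
      (seg (suc k) (map dualᵐ (carry τ ys ∷ Ms ++ carry τ zs ∷ Ms′)))
    ⊢ cᵢₙ k xs (cₒᵤₜ k′ ys (cₒᵤₜ j zs nil)) ∥ Q₁ ∥ Q₂ ok
split-ok {τ = τ} {k = k} xs ys zs Ms {Ms′} n refl refl s ys⊆ zs⊆ q₁ q₂ =
  Par
    (cᵢₙ-ok xs (join-⊕⁺ seg-[]) n λ X ex →
      cₒᵤₜ-ok ys (provides-⊆ ex ys⊆)
        (join-⊕⁻ (⊞-⊕ (⊞-comm (λ w → proj₁ (proj₂ (pairs w)))) seg-[])) n
        (trailing zs (provides-⊆ ex zs⊆) n (λ _ → refl)))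
    (Par q₁ q₂ (λ _ → left)
      (join-⊞ s (seg-++ (carry τ ys ∷ Ms) {carry τ zs ∷ Ms′} (ℕ.+-suc (length Ms) (suc k)))
        (λ w → proj₂ (proj₂ (pairs w)))))
    (λ _ → left)
    (join-⊞ (λ _ → right) (seg-++ (carry τ xs ∷ []) {carry τ ys ∷ Ms ++ carry τ zs ∷ Ms′} refl)
      (λ w → proj₁ (pairs w)))
  where
  j = length Ms + suc (suc k)
  -- The outputs form two blocks, one per component. The head of each goes to the prefix, which
  -- triggers both components; the tails stay with `Q₁` and `Q₂`.
  pairs = λ w → split-interchange
    (seg-++-dual {suc k} {j} (carry τ ys ∷ Ms) {carry τ zs ∷ Ms′} (ℕ.+-suc (length Ms) (suc k)) w)
    (seg-++ (dualᵐ (carry τ ys) ∷ []) {map dualᵐ Ms} refl w)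
    (seg-++ {j = suc j} (dualᵐ (carry τ zs) ∷ []) {map dualᵐ Ms′} refl w)

-- The first input type is fixed by the context `xs`, so only the other `n - 1` are existential.
-- They are also the outputs, since the output on `c_k` lies outside.
Breakdown : Env Identᵐ UTyᵐ → SessEnvᵐ → Typing → ℕ → List Var → ℕ → Procᵐ → Set
Breakdown N D τ k xs n R = Σ[ Ms ∈ List STyᵐ ] suc (length Ms) ≡ n ×
  ∅ ∣ N ∣ join D (seg k (carry τ xs ∷ Ms)) (seg (suc k) (map dualᵐ Ms)) ⊢ R ok

-- An abstraction contains its own trigger, so inputs and outputs start at the same `k`. As the
-- value stands under a prefix, it is typed in any environment that provides its variables.
Breakdownᵛ : Env Identᵐ UTyᵐ → SessEnvᵐ → Typing → ℕ → List Var → ℕ → Valᵐ → UTyᵐ → Set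
Breakdownᵛ N D τ k xs n V U = Σ[ Ms ∈ List STyᵐ ] length Ms ≡ n × (∀ X → Provides X τ xs →
  ⟨ X ⨾ N ⟩ ∣ ∅ ∣ join D (seg k Ms) (seg k (map dualᵐ Ms)) ⊢ᵐᵛ V ▷ U)

∈-∪ʳ : ∀ {x} xs {ys} → x ∈ ys → x ∈ xs ∪ ys
∈-∪ʳ {x} xs m with x ∈ᵛ? xs
... | yes m′ = ∈-++⁺ˡ m′
... | no m′ = ∈-++⁺ʳ xs (∈-filter⁺ (λ y → ¬? (y ∈ᵛ? xs)) m m′)

∈-without⁻ : ∀ {u v us} → v ∈ us without u → v ∈ us × v ≢ u
∈-without⁻ {u} m = ∈-filter⁻ (λ v → ¬? (v ≟ u)) m

∈-without : ∀ {u v us} → v ≢ u → v ∈ us → v ∈ us without u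
∈-without {u} v≢u m = ∈-filter⁺ (λ v → ¬? (v ≟ u)) m v≢u

-- Shadowing is harmless: the context of an input omits `x`, so an exact environment has no outer
-- `x` and the new type can be written over it.
receive-scope : ∀ {x} zs C → Exact X τ (filter (λ y → ¬? (y ℕ.≟ x)) zs) →
  X ≐ Upˣ.update X (src x) (just (𝒢ᶜ C)) ∖ src x ×
  Provides (Upˣ.update X (src x) (just (𝒢ᶜ C))) (Upᵛ.update τ x C) zs
receive-scope {X = X} {τ = τ} {x = x} zs C ex =
  record
    { gone = ex .outside λ m → proj₂ (∈-filter⁻ (λ y → ¬? (y ℕ.≟ x)) {xs = zs} m) refl
    ; kept = λ v v≢ → sym (Upˣ.update-other X {u = src x} v≢)
    } ,
  provides known
  where
  known : ∀ {y} → y ∈ zs → Upˣ.update X (src x) (just (𝒢ᶜ C)) (src y) ≡ just (𝒢ᶜ (Upᵛ.update τ x C y))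
  known {y} m with y ℕ.≟ x
  ... | yes refl = trans (Upˣ.update-same X (src x)) (cong (λ D → just (𝒢ᶜ D)) (sym (Upᵛ.update-same τ x)))
  ... | no y≢x = trans (Upˣ.update-other X {u = src x} {src y} λ { refl → y≢x refl })
    (trans (ex .inside .provided (∈-filter⁺ (λ y → ¬? (y ℕ.≟ x)) m y≢x))
      (cong (λ D → just (𝒢ᶜ D)) (sym (Upᵛ.update-other τ y≢x))))

∖∖-singleton : {f g : Env K A} {u : K} → f ≐ g ∖ u → f ≐ g ∖∖ (u ∷ [])
∖∖-singleton e = record
  { gone = λ { _ (here refl) → e .gone }
  ; kept = λ v m → e .kept v λ { refl → m (here refl) } }

var-value : ∀ {Γ Λ Δ x m C k} → Γ ∣ Λ ∣ Δ ⊢ᵛ var x ▷ fun m C → Covers (vars Γ) Λ τ →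
  Tracks (chans Γ) Δ us E L →
  Breakdownᵛ (𝒩 (chans Γ) ρ) (⟦ L ⟧ ρ) τ k (x ∷ []) 0 (var (src x)) (fun m (𝒢ᶜ C))
var-value {τ = τ} {Γ = Γ} {Λ = Λ} {x = x} {m} {C} d c t with ⊢var-inv d
... | inv , z = [] , refl , λ X pr →
  var-ok m (trans (pr .provided (here refl)) (cong (λ C → just (𝒢ᶜ C)) (τx inv)))
    (join-≐∅ (⟦⟧-≐∅ λ u → shape-nothing (t .shape u) (z u)) (λ _ → refl) (λ _ → refl))
  where
  τx : (vars Γ x ≡ just C × Λ ≐∅ ⊎ vars Γ x ≡ nothing × Λ ≐ ∅ ⊕ x ∶ C) → τ x ≡ C
  τx (inj₁ (e , _)) = c .unr-var e
  τx (inj₂ (_ , e)) = c .lin-var (e .at)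

next-stable : ∀ {N : Env Ident UTy} {Δ u S} → Disjoint N Δ → Δ u ≡ just S → E u ≡ just (sess S) →
  ∀ v U → N v ≡ just U → next E u ρ v ≡ ρ v
next-stable {E = E} {ρ = ρ} {u = u} dis e i v U n with v ≟ u
... | yes refl = contradiction (trans (sym n) (disjoint-absent dis e)) λ ()
... | no v≢u = trans (cong (λ σ → σ v) (next-sess {E = E} {ρ = ρ} i)) (Upᴵ.update-other ρ v≢u)

length-parts : ∀ {M : STyᵐ} Ms {Ms′ m n} → length Ms ≡ m → suc (length Ms′) ≡ n →
  suc (length (Ms ++ M ∷ Ms′)) ≡ m + n + 1
length-parts Ms {Ms′} refl refl =
  trans (cong suc (length-++ Ms)) (ℕ.+-comm 1 (length Ms + suc (length Ms′)))

index : ∀ k {l m} → m ≡ l → k + l + 1 ≡ m + (k + 1)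
index k {l} refl = trans (cong (_+ 1) (ℕ.+-comm k l)) (ℕ.+-assoc l k 1)

lamBody : TypeInfo → Indexing → ℕ → ℕ → CTy → Proc → Procᵐ
lamBody E ρ k y C P =
  cₒᵤₜ k (fhv P) nil ∥ ℬ (E [ nvar y ↦ just C ]) (ρ [ nvar y ↦ 1 ]) k (fhv P) P

mutual
  -- Everything but the derivation stays general, because each subprocess is broken down at its own
  -- indexing, propagator index and type information. Rules that keep the process also keep the list
  -- of propagator types.
  ℬ-ok : ∀ {Γ Λ Δ P} → Γ ∣ Λ ∣ Δ ⊢ P → NoUseAfterEnd E P → Covers (vars Γ) Λ τ →
    Tracks (chans Γ) Δ (fid P) E L → ∀ ρ k →
    Breakdown (𝒩 (chans Γ) ρ) (⟦ L ⟧ ρ) τ k (fhv P) ∣ P ∣ (ℬ E ρ k (fhv P) P)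
  ℬ-ok {τ = τ} (Nil _ z) _ _ t ρ k =
    [] , refl , cᵢₙ-ok {τ = τ} [] (join-⊕⁺ seg-[]) refl λ _ _ →
      Nil (λ _ → refl) (join-≐∅ (⟦⟧-≐∅ λ u → shape-nothing (t .shape u) (z u)) (λ _ → refl) (λ _ → refl))
  ℬ-ok (EProm e f d) nu c t ρ k = ℬ-ok d nu (covers-move e f c) t ρ k
  ℬ-ok {E = E} {τ = τ} {L = L} {Γ} (App {Δ₁ = Δ₁} {Δ₂} {V = V} {u} {m} {C = C} v n s) nu c t ρ k
    with 𝒱-ok v nu c (tracks-⊞ s there t) ρ (k + 1)
  ... | Ms , len , tv =
    Ms , trans (cong suc len) (ℕ.+-comm 1 ∣ V ∣ᵛ) ,
    cᵢₙ-ok (fhvᵛ V) (join-⊕⁺ (seg-∷ {xs = Ms})) refl λ X ex →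
      App
        (subst
          (λ j → ⟨ X ⨾ 𝒩 (chans Γ) ρ ⟩ ∣ ∅ ∣ join (⟦ L ↾ Δ₁ ⟧ ρ) (seg j Ms) (seg j (map dualᵐ Ms)) ⊢ᵐᵛ
            𝒱 E ρ (k + 1) (fhvᵛ V) V ▷ fun m (𝒢ᶜ C))
          (ℕ.+-comm k 1) (tv X (ex .inside)))
        (subst
          (λ n → ⟨ X ⨾ 𝒩 (chans Γ) ρ ⟩ ∣ ⟦ L ↾ Δ₂ ⟧ ρ ⊢ᵐⁿ⋆
            map (idx u) (interval (ρ u) n) ▷ 𝒢ᶜ C)
          (sym (cong (Maybe.maybe (λ C → length (𝒢ᶜ C)) 0) (name-info n t₂)))
          (names-ok n (name-row n (here refl) t₂)))
        (join-⊞ⁿ (⟦⟧-⊞ s t) λ _ _ → refl)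
    where
    t₂ : Tracks (chans Γ) Δ₂ (u ∷ []) E (L ↾ Δ₂)
    t₂ = tracks-⊞ (⊞-comm s) (λ { (here e) → here e }) t
  ℬ-ok {E = E} {τ = τ} {L = L} {Γ}
    whole@(Send {Δ₁ = Δ₁} {Δ₂} {u} {U} {S} {V} {P} s e d v l f) (unused , nuV , nuP) c t ρ k =
    Ms ++ carry τ (fhv P) ∷ Ms′ , length-parts Ms {Ms′} len len′ ,
    prefix-ok (fhv (out u V P)) Ms {Ms′ = Ms′} refl (ℕ.+-comm k 1) j≡ (Upᵐ.⊞-extend step (⊞-comm rest))
      (λ X ex → send (join-⊕ⁿ (Upᵐ.extend (⊞-nothing (⊞-comm rest) (step .fresh)))) (payload-⊞ Ms j≡)
        (𝒩-nothing {ρ = ρ} {N = chans Γ} {u} {ρ u} (disjoint-absent dis (f .at)))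
        (trailing (fhv P) (provides-⊆ ex (∈-∪ʳ (fhvᵛ V))) refl (λ _ → refl))
        (cons (raiseᵛ (𝒩-disjoint (proj₂ (⊢ᵛ-disjoint v)) t₂) stable (tv X (provides-⊆ ex ∈-++⁺ˡ)))
          ([] (λ _ → refl) (λ _ → refl)) (λ _ → left) (λ _ → left)))
      (raise (𝒩-disjoint (proj₂ (⊢-disjoint d)) t₁) (λ _ _ ()) stable tp)
    where
    -- The rest of the session on `u` may be used by `P` or inside `V`, so both are broken down
    -- after the communication, under `σ`.
    σ = next E u ρ
    dis = proj₂ (⊢-disjoint whole)
    t′ = tracks-comm !⨾ f e dis
      (λ fin m → [ proj₁ (unused fin) , proj₂ (unused fin) ] (∈-++⁻ (fidᵛ V) m)) t
    t₁ = tracks-⊞ s (∈-++⁺ʳ (fidᵛ V)) t′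
    t₂ = tracks-⊞ (⊞-comm s) ∈-++⁺ˡ t′
    step = ⟦⟧-comm !⨾ f e {ρ = ρ} t
    rest = ⟦⟧-⊞ {ρ = σ} s t′
    stable : 𝒩 (chans Γ) σ ⊑ 𝒩 (chans Γ) ρ
    stable = 𝒩-⊑ (λ _ _ eq → eq) (next-stable {E = E} dis (f .at) (t .sess-info (f .at)))
    value = 𝒱-ok v nuV (covers-⊞ (⊞-comm l) c) t₂ σ (k + 1)
    Ms = proj₁ value
    len = proj₁ (proj₂ value)
    j≡ = index k len
    tv = proj₂ (proj₂ value)
    cont = ℬ-ok d nuP (covers-⊞ l c) t₁ σ (k + ∣ V ∣ᵛ + 1)
    Ms′ = proj₁ cont
    len′ = proj₁ (proj₂ cont)
    tp = proj₂ (proj₂ cont)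
  ℬ-ok {E = E} {τ = τ} {L = L} {Γ}
    whole@(Rcv {u = u} {U = fun m C} {S} {x} {P} e d _ v g l f) (unused , nuP) c t ρ k =
    -- The next propagator may carry `x` itself, hence `τ′` instead of `τ`.
    carry τ′ (fhv P) ∷ Ms , length-parts {carry τ′ (fhv P)} [] {Ms} refl len ,
    prefix-ok (fhv (inp u x P)) [] {Ms′ = Ms} refl (ℕ.+-comm k 1) refl (Upᵐ.⊞-extend step (λ _ → right))
      (λ X ex → receive (join-⊕ⁿ (Upᵐ.extend refl))
        (𝒩-nothing {ρ = ρ} {N = chans Γ} {u} {ρ u} (disjoint-absent dis (f .at)))
        (trailing (fhv P) (proj₂ (receive-scope (fhv P) C ex)) refl (λ _ → refl))
        (cons (var-ok m (Upˣ.update-same X (src x)) (λ _ → refl)) ([] (λ _ → refl) (λ _ → refl))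
          (λ _ → left) (λ _ → left))
        (∖∖-singleton (proj₁ (receive-scope (fhv P) C ex))))
      (raise (𝒩-disjoint (proj₂ (⊢-disjoint d)) t′) (λ _ _ ()) stable tp)
    where
    σ = next E u ρ
    τ′ = Upᵛ.update τ x C
    dis = proj₂ (⊢-disjoint whole)
    t′ = tracks-comm ¿⨾ f e dis unused t
    step = ⟦⟧-comm ¿⨾ f e {ρ = ρ} t
    stable : 𝒩 (chans Γ) σ ⊑ 𝒩 (chans Γ) ρ
    stable = 𝒩-⊑ (λ _ _ eq → eq) (next-stable {E = E} dis (f .at) (t .sess-info (f .at)))
    cont = ℬ-ok d nuP (covers-bind v (proj₁ (⊢-disjoint d)) g l c) t′ σ (k + 1)
    Ms = proj₁ cont
    len = proj₁ (proj₂ cont)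
    tp = proj₂ (proj₂ cont)
  ℬ-ok {E = E} {τ = τ} {L = L} {Γ} {Δ = Δ} (Req {Δ₁ = Δ₁} {Δ₂} {u} {U} {V} {P} _ (Sh n _) d z v s)
    (_ , nuV , nuP) c t ρ k =
    Ms ++ carry τ (fhv P) ∷ Ms′ , length-parts Ms {Ms′} len len′ ,
    prefix-ok (fhv (out u V P)) Ms {Ms′ = Ms′} refl (ℕ.+-comm k 1) j≡ (⊞-comm (⟦⟧-⊞ s t))
      (λ X ex → Req (λ _ → refl) (Sh (𝒩-just {ρ = ρ} {N = chans Γ} n) (λ _ → refl))
        (trailing (fhv P) (provides-⊆ ex (∈-∪ʳ (fhvᵛ V))) refl (λ _ → refl))
        (λ _ → refl) (tv X (provides-⊆ ex ∈-++⁺ˡ)) (payload-⊞ Ms j≡))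
      tp
    where
    -- On a channel `advance` and `next` change nothing, but they reduce only once `E u` is known;
    -- hence the transports here and below.
    t′ = subst (λ E → Tracks (chans Γ) Δ _ E L) (sym (advance-chan {E = E} (t .chan-info n))) t
    value = subst
      (λ σ → Breakdownᵛ (𝒩 (chans Γ) σ) (⟦ L ↾ Δ₂ ⟧ σ) τ (k + 1) (fhvᵛ V) ∣ V ∣ᵛ
        (𝒱 (advance E u) (next E u ρ) (k + 1) (fhvᵛ V) V) (𝒢ᵁ U))
      (next-chan {E = E} {ρ = ρ} (t .chan-info n))
      (𝒱-ok v nuV (covers-⊞ (⊞-comm (⊞-∅ʳ z)) c)
        (tracks-⊞ (⊞-comm s) (λ m → there (∈-++⁺ˡ m)) t′) (next E u ρ) (k + 1))
    Ms = proj₁ value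
    len = proj₁ (proj₂ value)
    tv = proj₂ (proj₂ value)
    j≡ = index k len
    cont = subst
      (λ σ → Breakdown (𝒩 (chans Γ) σ) (⟦ L ↾ Δ₁ ⟧ σ) τ (k + ∣ V ∣ᵛ + 1) (fhv P) ∣ P ∣
        (ℬ (advance E u) (next E u ρ) (k + ∣ V ∣ᵛ + 1) (fhv P) P))
      (next-chan {E = E} {ρ = ρ} (t .chan-info n))
      (ℬ-ok d nuP c (tracks-⊞ s (λ m → there (∈-++⁺ʳ (fidᵛ V) m)) t′) (next E u ρ) (k + ∣ V ∣ᵛ + 1))
    Ms′ = proj₁ cont
    len′ = proj₁ (proj₂ cont)
    tp = proj₂ (proj₂ cont)
  ℬ-ok {E = E} {τ = τ} {L = L} {Γ} {Δ = Δ} (Acc {u = u} {U = fun m C} {x} {P} _ (Sh n _) d _ v g l)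
    (_ , nuP) c t ρ k =
    carry τ′ (fhv P) ∷ Ms , length-parts {carry τ′ (fhv P)} [] {Ms} refl len ,
    prefix-ok (fhv (inp u x P)) [] {Ms′ = Ms} refl (ℕ.+-comm k 1) refl (λ _ → right)
      (λ X ex → Acc (λ _ → refl) (Sh (𝒩-just {ρ = ρ} {N = chans Γ} n) (λ _ → refl))
        (trailing (fhv P) (proj₂ (receive-scope (fhv P) C ex)) refl (λ _ → refl))
        (λ _ → refl) (var-ok m (Upˣ.update-same X (src x)) (λ _ → refl))
        (proj₁ (receive-scope (fhv P) C ex)) (λ _ → left))
      tp
    where
    τ′ = Upᵛ.update τ x C
    t′ = subst (λ E → Tracks (chans Γ) Δ _ E L) (sym (advance-chan {E = E} (t .chan-info n)))
      (tracks-⊆ there t)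
    cont = subst
      (λ σ → Breakdown (𝒩 (chans Γ) σ) (⟦ L ⟧ σ) τ′ (k + 1) (fhv P) ∣ P ∣
        (ℬ (advance E u) (next E u ρ) (k + 1) (fhv P) P))
      (next-chan {E = E} {ρ = ρ} (t .chan-info n))
      (ℬ-ok d nuP (covers-bind v (proj₁ (⊢-disjoint d)) g l c) t′ (next E u ρ) (k + 1))
    Ms = proj₁ cont
    len = proj₁ (proj₂ cont)
    tp = proj₂ (proj₂ cont)
  ℬ-ok {τ = τ} (Par {P = P} {Q} d d′ l s) (nu , nu′) c t ρ k =
    carry τ (fhv P) ∷ Ms ++ carry τ (fhv Q) ∷ Ms′ ,
    length-parts (carry τ (fhv P) ∷ Ms) {Ms′} len len′ ,
    split-ok (fhv (P ∥ Q)) (fhv P) (fhv Q) Ms {Ms′} refl (ℕ.+-comm k 1)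
      (trans (index k len) (sym (ℕ.+-suc (length Ms) (k + 1))))
      (⟦⟧-⊞ s t) ∈-++⁺ˡ (∈-∪ʳ (fhv P)) (proj₂ (proj₂ first)) (proj₂ (proj₂ second))
    where
    first = ℬ-ok d nu (covers-⊞ l c) (tracks-⊞ s ∈-++⁺ˡ t) ρ (k + 1)
    Ms = proj₁ first
    len = proj₁ (proj₂ first)
    second = ℬ-ok d′ nu′ (covers-⊞ (⊞-comm l) c) (tracks-⊞ (⊞-comm s) (∈-++⁺ʳ (fid P)) t) ρ
      (k + ∣ P ∣ + 1)
    Ms′ = proj₁ second
    len′ = proj₁ (proj₂ second)
  ℬ-ok {L = L} {Γ} (End {u = u} d n e) nu c t ρ k
    with ℬ-ok d nu c (tracks-end e t) ρ k | shape-end (t .shape u) (e .at)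
  -- If the row is still `end ∷ []`, End is repeated on the minimal side. If it was used up by the
  -- last communication, there is no entry to add.
  ... | Ms , len , td | inj₁ row = Ms , len ,
    End td (𝒩-nothing {ρ = ρ} {N = chans Γ} {u} {ρ u} n)
      (join-⊕ⁿ (⟦⟧-⊕ row (Upᴵ.update-same L u) (inj₂ refl) λ v v≢u → Upᴵ.update-other L v≢u , refl))
  ... | Ms , len , td | inj₂ row = Ms , len ,
    ⊢ᵐ-resp (join-≗ (⟦⟧-cong same) (λ _ → refl) (λ _ → refl)) td
    where
    same : ∀ v → ρ v ≡ ρ v × (L [ u ↦ [] ]) v ≡ L v ⊎ (L [ u ↦ [] ]) v ≡ [] × L v ≡ []
    same v with v ≟ u
    ... | yes refl = inj₂ (refl , row)
    ... | no _ = inj₁ (refl , refl)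
  ℬ-ok {L = L} (Res {a = a} e d) nu c t ρ k
    with disjoint-absent (disjoint-sym (proj₂ (⊢-disjoint d))) (e .at)
  ... | fresh
    with ℬ-ok d nu c (tracks-bind-chan (λ _ → refl) (e .at) fresh (e .away) ∈-without t)
           (ρ [ shr a ↦ 1 ]) k
  ... | Ms , len , td = Ms , len ,
    Res (𝒩-⊕ e) (⊢ᵐ-resp (join-≗ (⟦⟧-cong same) (λ _ → refl) (λ _ → refl)) td)
    where
    same : ∀ v → (ρ [ shr a ↦ 1 ]) v ≡ ρ v × (L [ shr a ↦ [] ]) v ≡ L v ⊎
      (L [ shr a ↦ [] ]) v ≡ [] × L v ≡ []
    same v with v ≟ shr a
    ... | yes refl = inj₂ (refl , shape-nothing (t .shape v) fresh)
    ... | no _ = inj₁ (refl , refl)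
  ℬ-ok {E = E} {L = L} {Γ} {Δ = Δ} (ResS {Δ₁ = Δ₁} {Δ₂} {s} {S} {P} e f d) nu c t ρ k =
    proj₁ inner , proj₁ (proj₂ inner) ,
    νˢ⋆-ok 1 (𝒢ˢ S)
      (join-⊞ⁿ (λ w → proj₁ (rows w)) λ _ _ → refl)
      (λ w → proj₂ (rows w))
      (raise (𝒩-disjoint (proj₂ (⊢-disjoint d)) t₂) (λ _ _ ()) stable (proj₂ (proj₂ inner)))
    where
    ρ₁ = ρ [ ses pos s ↦ 1 ]
    ρ₂ = ρ₁ [ ses neg s ↦ 1 ]
    absent⁺ : chans Γ (ses pos s) ≡ nothing
    absent⁺ = disjoint-absent (disjoint-⊖ _≟_ (proj₂ (⊢-disjoint d)) f) (e .at)
    absent⁻ : chans Γ (ses neg s) ≡ nothing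
    absent⁻ = disjoint-absent (proj₂ (⊢-disjoint d)) (f .at)
    t₁ : Tracks (chans Γ) Δ₁ (fid P without ses neg s) (E [ ses pos s ↦ just (sess S) ])
      (L [ ses pos s ↦ 𝒢ˢ S ])
    t₁ = tracks-bind-sess e absent⁺
      (λ v≢ m → ∈-without (proj₂ (∈-without⁻ {ses neg s} {us = fid P} m))
        (∈-without {us = fid P} v≢ (proj₁ (∈-without⁻ {ses neg s} {us = fid P} m))))
      t
    t₂ : Tracks (chans Γ) Δ₂ (fid P) (bindˢ s S E) ((L [ ses pos s ↦ 𝒢ˢ S ]) [ ses neg s ↦ 𝒢ˢ (dual S) ])
    t₂ = tracks-bind-sess f absent⁻ ∈-without t₁
    inner = ℬ-ok d nu c t₂ ρ₂ k
    stable : 𝒩 (chans Γ) ρ₂ ⊑ 𝒩 (chans Γ) ρ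
    stable = 𝒩-⊑ (λ _ _ eq → eq) same
      where
      same : ∀ v U → chans Γ v ≡ just U → ρ₂ v ≡ ρ v
      same v U eq with v ≟ ses neg s | v ≟ ses pos s
      ... | yes refl | _ = contradiction (trans (sym eq) absent⁻) λ ()
      ... | no _ | yes refl = contradiction (trans (sym eq) absent⁺) λ ()
      ... | no _ | no _ = refl
    rows⁻ : ⟦ (L [ ses pos s ↦ 𝒢ˢ S ]) [ ses neg s ↦ 𝒢ˢ (dual S) ] ⟧ ρ₂ ≐
      ⟦ L [ ses pos s ↦ 𝒢ˢ S ] ⟧ ρ₁ ⊞ single (ses neg s) 1 (map dualᵐ (𝒢ˢ S))
    rows⁻ rewrite 𝒢ˢ-dual S = ⟦⟧-bind (𝒢ˢ (dual S)) (shape-nothing (t₁ .shape (ses neg s)) (f .fresh))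
    rows⁺ = ⟦⟧-bind {ρ = ρ} {i = 1} (𝒢ˢ S) (shape-nothing (t .shape (ses pos s)) (e .fresh))
    -- The endpoints were bound one after the other; `νˢ⋆-ok` expects them as one pair beside the
    -- outer environment.
    rows = λ w → split-assocʳ (rows⁻ w) (rows⁺ w)
  ℬ-ok (Weak (⊑ᵛ , ⊑ᶜ) (_ , dis) d) nu c t ρ k
    with ℬ-ok d nu (covers-⊑ ⊑ᵛ c) (tracks-⊑ ⊑ᶜ t) ρ k
  ... | Ms , len , td = Ms , len ,
    raise (𝒩-disjoint dis t) (λ _ _ ()) (𝒩-⊑ ⊑ᶜ (λ _ _ _ → refl)) td

  𝒱-ok : ∀ {Γ Λ Δ V U} → Γ ∣ Λ ∣ Δ ⊢ᵛ V ▷ U → NoUseAfterEndᵛ E V → Covers (vars Γ) Λ τ →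
    Tracks (chans Γ) Δ (fidᵛ V) E L → ∀ ρ k →
    Breakdownᵛ (𝒩 (chans Γ) ρ) (⟦ L ⟧ ρ) τ k (fhvᵛ V) ∣ V ∣ᵛ (𝒱 E ρ k (fhvᵛ V) V) (𝒢ᵁ U)
  𝒱-ok d@(LVar _ _ _) _ c t ρ k = var-value d c t
  𝒱-ok d@(Prom-var _ _ _) _ c t ρ k = var-value d c t
  𝒱-ok (EProm e f d) nu c t ρ k = 𝒱-ok d nu (covers-move e f c) t ρ k
  𝒱-ok (Weak (⊑ᵛ , ⊑ᶜ) (_ , dis) d) nu c t ρ k
    with 𝒱-ok d nu (covers-⊑ ⊑ᵛ c) (tracks-⊑ ⊑ᶜ t) ρ k
  ... | Ms , len , td = Ms , len , λ X p →
    raiseᵛ (𝒩-disjoint dis t) (𝒩-⊑ ⊑ᶜ (λ _ _ _ → refl)) (td X p)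
  𝒱-ok d@(Abs _ _ _ _) nu c t ρ k with lam-ok d nu c t ρ k
  ... | Ms , len , td = Ms , len , λ X p → proj₁ (td X p)
  𝒱-ok (Prom-lam _ z d) nu c t ρ k with lam-ok d nu c t ρ k
  ... | Ms , len , td = [] , refl , λ X p →
    Prom-lam (λ _ → refl)
      (join-≐∅ (⟦⟧-≐∅ λ u → shape-nothing (t .shape u) (z u)) (λ _ → refl) (λ _ → refl))
      (proj₂ (td X p))

  -- Prom-lam concludes from the linear abstraction, but the breakdown of the unrestricted one has a
  -- different body, with its propagators restricted. Both bodies are therefore typed at Abs, and
  -- the pair is carried through EProm and Weak.
  lam-ok : ∀ {Γ Λ Δ y C P U} → Γ ∣ Λ ∣ Δ ⊢ᵛ lam y C lin P ▷ U → NoUseAfterEnd (E [ nvar y ↦ just C ]) P →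
    Covers (vars Γ) Λ τ → Tracks (chans Γ) Δ (fid P without nvar y) E L → ∀ ρ k →
    Σ[ Ms ∈ List STyᵐ ] length Ms ≡ ∣ P ∣ × (∀ X → Provides X τ (fhv P) →
      ⟨ X ⨾ 𝒩 (chans Γ) ρ ⟩ ∣ ∅ ∣ join (⟦ L ⟧ ρ) (seg k Ms) (seg k (map dualᵐ Ms)) ⊢ᵐᵛ
        lam (map (y ,_) (interval 1 (length (𝒢ᶜ C)))) (𝒢ᶜ C) lin (lamBody E ρ k y C P) ▷ 𝒢ᵁ U ×
      ⟨ X ⨾ 𝒩 (chans Γ) ρ ⟩ ∣ ∅ ∣ join (⟦ L ⟧ ρ) ∅ ∅ ⊢ᵐᵛ
        lam (map (y ,_) (interval 1 (length (𝒢ᶜ C)))) (𝒢ᶜ C) lin (νᶜ k ∣ P ∣ (lamBody E ρ k y C P)) ▷ 𝒢ᵁ U)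
  lam-ok (EProm e f d) nu c t ρ k = lam-ok d nu (covers-move e f c) t ρ k
  lam-ok (Weak (⊑ᵛ , ⊑ᶜ) (_ , dis) d) nu c t ρ k
    with lam-ok d nu (covers-⊑ ⊑ᵛ c) (tracks-⊑ ⊑ᶜ t) ρ k
  ... | Ms , len , td = Ms , len , λ X p →
    raiseᵛ (𝒩-disjoint dis t) (𝒩-⊑ ⊑ᶜ (λ _ _ _ → refl)) (proj₁ (td X p)) ,
    raiseᵛ (𝒩-disjoint dis t) (𝒩-⊑ ⊑ᶜ (λ _ _ _ → refl)) (proj₂ (td X p))
  lam-ok {E = E} {τ = τ} {L = L} {Γ} {y = y} {C} {P} (Abs {N₁ = N₁} d n f s) nu c t ρ k
    with tracks-bind n (proj₂ (⊢-disjoint d)) f s ∈-without t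
  ... | t′ with ℬ-ok d nu c t′ (ρ [ nvar y ↦ 1 ]) k
  ... | Ms , len , td = carry τ (fhv P) ∷ Ms , len , λ X p →
    abstracted X (seg k Ns) (seg k (map dualᵐ Ns)) (typed X p) ,
    abstracted X ∅ ∅
      (subst (λ n → X ∣ 𝒩 N₁ ρ₁ ∣ join (⟦ L₁ ⟧ ρ₁) ∅ ∅ ⊢ νᶜ k n (lamBody E ρ k y C P) ok) len
        (νᶜ-ok k Ns (join-⊞ (λ _ → left) (λ _ → right) (λ _ → right))
          (join-⊞ (λ _ → left) (λ _ → left) (λ _ → right)) (typed X p)))
    where
    Ns = carry τ (fhv P) ∷ Ms
    ρ₁ = ρ [ nvar y ↦ 1 ]
    L₁ = L [ nvar y ↦ rowOf C ]
    typed : ∀ X → Provides X τ (fhv P) →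
      X ∣ 𝒩 N₁ ρ₁ ∣ join (⟦ L₁ ⟧ ρ₁) (seg k Ns) (seg k (map dualᵐ Ns)) ⊢ lamBody E ρ k y C P ok
    typed X p = trigger-ok (fhv P) Ms refl p (𝒩-disjoint (proj₂ (⊢-disjoint d)) t′) td
    names≡ : map (idx (nvar y)) (interval 1 (length (𝒢ᶜ C))) ≡
      map nvarᵐ (map (y ,_) (interval 1 (length (𝒢ᶜ C))))
    names≡ = map-∘ (interval 1 (length (𝒢ᶜ C)))
    abstracted : ∀ X p n {R} → X ∣ 𝒩 N₁ ρ₁ ∣ join (⟦ L₁ ⟧ ρ₁) p n ⊢ R ok →
      ⟨ X ⨾ 𝒩 (chans Γ) ρ ⟩ ∣ ∅ ∣ join (⟦ L ⟧ ρ) p n ⊢ᵐᵛ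
        lam (map (y ,_) (interval 1 (length (𝒢ᶜ C)))) (𝒢ᶜ C) lin R ▷ fun lin (𝒢ᶜ C)
    abstracted X p m r = Abs r
      (subst (λ us → ⟨ X ⨾ 𝒩 N₁ ρ₁ ⟩ ∣ single (nvar y) 1 (rowOf C) ⊢ᵐⁿ⋆ us ▷ 𝒢ᶜ C) names≡
        (subst (λ i → ⟨ X ⨾ 𝒩 N₁ ρ₁ ⟩ ∣ single (nvar y) 1 (rowOf C) ⊢ᵐⁿ⋆
            map (idx (nvar y)) (interval i (length (𝒢ᶜ C))) ▷ 𝒢ᶜ C)
          (Upᴵ.update-same ρ (nvar y)) (names-ok {ρ = ρ₁} n row)))
      (subst (λ us → 𝒩 (chans Γ) ρ ≐ 𝒩 N₁ ρ₁ ∖∖ us) names≡ (𝒩-∖∖ n f))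
      (join-⊞ⁿ (⟦⟧-bind (rowOf C)
        (shape-nothing (t .shape (nvar y)) (binder-fresh n (proj₂ (⊢-disjoint d)) s)))
        λ _ _ → refl)
      where
      row : single (nvar y) 1 (rowOf C) ≗ single (nvar y) (ρ₁ (nvar y)) (rowOf C)
      row rewrite Upᴵ.update-same ρ (nvar y) {1} = λ _ → refl

-- The environments of the whole process

seg-drop : ∀ i (xs : List A) j → (if i ℕ.≤ᵇ j then head (drop (j ∸ i) xs) else nothing) ≡ seg i xs j
seg-drop i xs j with i ℕ.≤? j
... | no i≰j rewrite dec-false (i ℕ.≤? j) i≰j = sym (seg-below xs (ℕ.≰⇒> i≰j))
... | yes i≤j rewrite dec-true (i ℕ.≤? j) i≤j =
  trans (offset xs (j ∸ i)) (cong (seg i xs) (ℕ.m∸n+n≡m i≤j))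
  where
  offset : ∀ {i} (xs : List A) d → head (drop d xs) ≡ seg i xs (d + i)
  offset [] ℕ.zero = refl
  offset [] (suc d) = refl
  offset {i = i} (x ∷ xs) ℕ.zero rewrite dec-true (i ℕ.≟ i) refl = refl
  offset {i = i} (x ∷ xs) (suc d)
    rewrite dec-false (suc d + i ℕ.≟ i) (λ eq → ℕ.m≢1+n+m i (sym eq)) =
    trans (offset xs d) (cong (seg (suc i) xs) (ℕ.+-suc d i))

rowsOf : SessEnv → Rows
rowsOf Δ u = Maybe.maybe′ 𝒢ˢ [] (Δ u)

𝒢Δ-rows : ∀ Δ ρ → ⟦ rowsOf Δ ⟧ ρ ≗ 𝒢Δ Δ ρ
𝒢Δ-rows Δ ρ (prp _ _) = refl
𝒢Δ-rows Δ ρ (idx u i) with Δ u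
... | just S = sym (seg-drop (ρ u) (𝒢ˢ S) i)
... | nothing with ρ u ℕ.≤ᵇ i
...   | true = refl
...   | false = refl

info-tracks : ∀ {Γ Δ} → Disjoint (chans Γ) Δ → Tracks (chans Γ) Δ us (info Γ Δ) (rowsOf Δ)
info-tracks dis .sess-info e rewrite e = refl
info-tracks {Γ = Γ} {Δ} dis .chan-info {u} e
  rewrite disjoint-absent (disjoint-sym dis) e | e = refl
info-tracks {Δ = Δ} dis .shape u with Δ u
... | just _ = present
... | nothing = absent

theorem3p11 : (P : Proc) (Γ : SharedEnv) (Δ : SessEnv) (k : ℕ) →
    Closed P →
    NoUseAfterEnd (info Γ Δ) P →
    k > 0 →
    Γ ∣ ∅ ∣ Δ ⊢ P →
    𝒢Γ Γ (init (fn P)) ∣ ∅ ∣ 𝒢Δ Δ (init (fn P)) ⊢ᵐ 𝒟 Γ Δ k P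
theorem3p11 P Γ Δ k (closed , _) nu _ d =
  -- Weak only exchanges `𝒩` for the pointwise equal channel map of `𝒢Γ`, because `⊢ᵐ-resp` acts on
  -- session environments alone.
  Weak {Γ₀ = ⟨ vars (𝒢Γ Γ σ) ⨾ 𝒩 (chans Γ) σ ⟩}
    ((λ _ _ e → e) , λ w _ e → trans (sym (same w)) e)
    ((λ _ → inj₂ refl) , λ w → subst₂ (λ m n → m ≡ nothing ⊎ n ≡ nothing) (same w) (names w)
      (𝒩-disjoint {ρ = σ} dis t w))
    (⊢ᵐ-resp names
      (subst (λ n → vars (𝒢Γ Γ σ) ∣ 𝒩 (chans Γ) σ ∣ join (⟦ rows ⟧ σ) ∅ ∅ ⊢ νᶜ k n process ok) len
        (νᶜ-ok k Ns (join-⊞ (λ _ → left) (λ _ → right) (λ _ → right))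
          (join-⊞ (λ _ → left) (λ _ → left) (λ _ → right))
          (trigger-ok {τ = typing} [] Ms refl (provides λ ()) (𝒩-disjoint dis t) td))))
  where
  σ = init (fn P)
  rows = rowsOf Δ
  process = cₒᵤₜ k [] nil ∥ ℬ (info Γ Δ) σ k [] P
  typing : Typing
  -- The default `sess end` is arbitrary: `Covers` constrains only the variables that have an entry.
  typing x = Maybe.fromMaybe (sess end) (vars Γ x)
  dis = proj₂ (⊢-disjoint d)
  t : Tracks (chans Γ) Δ (fid P) (info Γ Δ) rows
  t = info-tracks dis
  breakdown = subst
    (λ xs → Breakdown (𝒩 (chans Γ) σ) (⟦ rows ⟧ σ) typing k xs ∣ P ∣ (ℬ (info Γ Δ) σ k xs P)) closed
    (ℬ-ok d nu (record { unr-var = cong (Maybe.fromMaybe (sess end)) ; lin-var = λ () }) t σ k)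
  Ms = proj₁ breakdown
  Ns = carry typing [] ∷ Ms
  len = proj₁ (proj₂ breakdown)
  td = proj₂ (proj₂ breakdown)
  same : 𝒩 (chans Γ) σ ≗ chans (𝒢Γ Γ σ)
  same (idx _ _) = refl
  same (prp _ _) = refl
  names : join (⟦ rows ⟧ σ) ∅ ∅ ≗ 𝒢Δ Δ σ
  names w@(idx _ _) = 𝒢Δ-rows Δ σ w
  names (prp pos _) = refl
  names (prp neg _) = refl
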